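{- For any even prime power $q$, there exist the following pencil arcs in $\Pi_2(q^2)$: (i) a regular $(q+1,\,q)$-parc; (ii) a regular $((q+2)/2,\,2q)$-parc.
   Context: $\Pi_2(n)$ denotes the desarguesian projective plane over $GF(n)$. A pencil in $\Pi_2(n)$ is the set of all $n+1$ lines $\Psi_0,\ldots,\Psi_n$ through some common point. A $k$-parc (pencil arc) in $\Pi_2(n)$ with pencil $\Psi_0,\ldots,\Psi_n$ is a set $\mathcal{K}$ of $k$ points such that: (a) each $\mathcal{K}\cap\Psi_i$ is an $h_i$-arc in the projective line $\Psi_i$, where $h_i=|\mathcal{K}\cap\Psi_i|$ (i.e. any two of its points are independent, which is automatic); (b) $\mathcal{K}\cap\Psi_i\cap\Psi_j=\emptyset$ for $i\neq j$; (c) any three points of $\mathcal{K}$ not contained in any single $\Psi_i$ are linearly independent (non-collinear). A regular $(m,h)$-parc is a pencil arc for which, for a suitable labelling of the lines of the pencil, $h_0=h_1=\cdots=h_{m-1}=h$ and $h_m=\cdots=h_n=0$. -}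

module Defs where

open import Algebra.Apartness.Bundles using (HeytingCommutativeRing; HeytingField)
import Algebra.Apartness.Properties.HeytingCommutativeRing as HeytingProperties
open import Algebra.Bundles using (CommutativeRing)
import Algebra.Properties.CommutativeMonoid.Sum as Summation
import Algebra.Properties.Ring as RingProperties
open import Data.Fin.Base using (Fin; toℕ)
open import Data.Nat.Base using (ℕ; suc; _^_; _≤_; _<_)
open import Data.Nat.Primality using (Prime)
open import Data.Product.Base using (Σ; ∃; ∃-syntax; _×_; _,_; proj₁; proj₂)
open import Data.Vec.Functional using (Vector; []; _∷_)
open import Function.Bundles using (Bijection)
open import Level using (Level; _⊔_)
open import Relation.Binary.Bundles using (Setoid)
import Relation.Binary.Construct.On as On
open import Relation.Binary.Core using (Rel)
open import Relation.Binary.Definitions using (Reflexive; Symmetric; Transitive; _Respects_)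
open import Relation.Binary.PropositionalEquality as ≡ using (_≡_; _≢_)
import Relation.Binary.Reasoning.Setoid as SetoidReasoning
open import Relation.Nullary.Negation using (¬_)
open import Relation.Unary using (Pred; _∈_; _∩_; Empty)

IsPrimePower : ℕ → Set
IsPrimePower q = ∃[ p ] ∃[ e ] (Prime p × 1 ≤ e × q ≡ p ^ e)

module _ {a ℓ : Level} where

  _HasSize_ : Setoid a ℓ → ℕ → Set (a ⊔ ℓ)
  S HasSize n = Bijection (≡.setoid (Fin n)) S

  -- The elements of S satisfying P, compared as elements of S.
  restrict : ∀ {p} (S : Setoid a ℓ) → Pred (Setoid.Carrier S) p → Setoid (a ⊔ p) ℓ
  restrict S P = On.setoid {B = Σ (Setoid.Carrier S) P} S proj₁

-- A Heyting field with n elements is GF(n): its equality is decidable, and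
-- x # y is then the same as ¬ (x ≈ y).
HasOrder : ∀ {c ℓ₁ ℓ₂} → HeytingField c ℓ₁ ℓ₂ → ℕ → Set (c ⊔ ℓ₁)
HasOrder F n =
  CommutativeRing.setoid (HeytingCommutativeRing.commutativeRing (HeytingField.heytingCommutativeRing F))
    HasSize n

module ProjectivePlane {c ℓ₁ ℓ₂ : Level} (F : HeytingField c ℓ₁ ℓ₂) where

  open HeytingField F using (Carrier; _#_; #⇒invertible; heytingCommutativeRing)
  open HeytingCommutativeRing heytingCommutativeRing using (commutativeRing)
  open CommutativeRing commutativeRing
    using (_≈_; _*_; _-_; 0#; 1#; setoid; refl; sym; trans; +-congˡ; *-congˡ; *-congʳ;
           *-assoc; *-identityˡ; +-identityʳ; ring; +-commutativeMonoid)
  open Summation +-commutativeMonoid using (sum)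

  LinearlyIndependent : ∀ {m d} → Vector (Vector Carrier d) m → Set (c ⊔ ℓ₁)
  LinearlyIndependent {m} v =
    (a : Vector Carrier m) → (∀ j → sum (λ i → a i * v i j) ≈ 0#) → ∀ i → a i ≈ 0#

  -- Nonzero vectors, taken up to a nonzero scalar: they are the homogeneous
  -- coordinates of points and, dually, of lines.
  Homogeneous : Set (c ⊔ ℓ₂)
  Homogeneous = Σ (Vector Carrier 3) λ v → ∃[ i ] (v i # 0#)

  coords : Homogeneous → Vector Carrier 3
  coords = proj₁

  infix 4 _∼_
  _∼_ : Rel Homogeneous (c ⊔ ℓ₁ ⊔ ℓ₂)
  u ∼ v = ∃[ λ′ ] (λ′ # 0# × ∀ i → coords u i ≈ λ′ * coords v i)

  private
    x-0≈x : ∀ x → x - 0# ≈ x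
    x-0≈x x = trans (+-congˡ (RingProperties.-0#≈0# ring)) (+-identityʳ x)

    module P = HeytingProperties heytingCommutativeRing

    1#0 : 1# # 0#
    1#0 = P.invertibleˡ⇒# (1# , trans (*-identityˡ _) (x-0≈x 1#))

    ∼-refl : Reflexive _∼_
    ∼-refl = 1# , 1#0 , λ i → sym (*-identityˡ _)

    ∼-trans : Transitive _∼_
    ∼-trans (a , a#0 , p) (b , b#0 , q) =
      a * b , P.x#0y#0→xy#0 a#0 b#0 ,
      λ i → trans (p i) (trans (*-congˡ (q i)) (sym (*-assoc a b _)))

    ∼-sym : Symmetric _∼_
    ∼-sym {u} {v} (a , a#0 , p) with #⇒invertible a#0
    ... | b , ba≈1 , ab≈1 = b , b#0 , eq
      where
      open SetoidReasoning setoid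
      b#0 : b # 0#
      b#0 = P.invertibleˡ⇒# (a - 0# , trans (*-congˡ (x-0≈x b)) ab≈1)
      eq : ∀ i → coords v i ≈ b * coords u i
      eq i = begin
        coords v i                ≈⟨ *-identityˡ _ ⟨
        1# * coords v i           ≈⟨ *-congʳ ba≈1 ⟨
        b * (a - 0#) * coords v i ≈⟨ *-congʳ (*-congˡ (x-0≈x a)) ⟩
        b * a * coords v i        ≈⟨ *-assoc b a _ ⟩
        b * (a * coords v i)      ≈⟨ *-congˡ (p i) ⟨
        b * coords u i            ∎

  homogeneousSetoid : Setoid (c ⊔ ℓ₂) (c ⊔ ℓ₁ ⊔ ℓ₂)
  homogeneousSetoid = record
    { Carrier       = Homogeneous
    ; _≈_           = _∼_
    ; isEquivalence = record
      { refl = λ {u} → ∼-refl {u}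
      ; sym = λ {u} {v} → ∼-sym {u} {v}
      ; trans = λ {u} {v} {w} → ∼-trans {u} {v} {w}
      }
    }

  Point Line : Set (c ⊔ ℓ₂)
  Point = Homogeneous
  Line  = Homogeneous

  infix 4 _on_
  _on_ : Point → Line → Set ℓ₁
  p on l = sum (λ i → coords l i * coords p i) ≈ 0#

  PointsOf : Line → Pred Point ℓ₁
  PointsOf l p = p on l

  record Pencil (n : ℕ) : Set (c ⊔ ℓ₁ ⊔ ℓ₂) where
    field
      centre : Point
      lines  : restrict homogeneousSetoid (centre on_) HasSize suc n

    Ψ : Fin (suc n) → Line
    Ψ i = proj₁ (Bijection.to lines i)

  module _ {ℓ : Level} where

    ∣_∣≡_ : Pred Point ℓ → ℕ → Set (c ⊔ ℓ₁ ⊔ ℓ₂ ⊔ ℓ)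
    ∣ K ∣≡ k = restrict homogeneousSetoid K HasSize k

    -- An arc in PG(1,n) is a set of points any two of which are independent.
    record IsArcIn (l : Line) (h : ℕ) (A : Pred Point ℓ) : Set (c ⊔ ℓ₁ ⊔ ℓ₂ ⊔ ℓ) where
      field
        onLine      : ∀ {p} → p ∈ A → p on l
        size        : ∣ A ∣≡ h
        independent : ∀ {p q} → p ∈ A → q ∈ A → ¬ (p ∼ q) →
                      LinearlyIndependent (coords p ∷ coords q ∷ [])

  module _ {ℓ : Level} where

    record IsParc {n : ℕ} (pencil : Pencil n) (h : Fin (suc n) → ℕ) (k : ℕ)
                  (K : Pred Point ℓ) : Set (c ⊔ ℓ₁ ⊔ ℓ₂ ⊔ ℓ) where
      open Pencil pencil
      field
        respects    : K Respects _∼_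
        size        : ∣ K ∣≡ k
        arcs        : ∀ i → IsArcIn (Ψ i) (h i) (K ∩ PointsOf (Ψ i))
        disjoint    : ∀ {i j} → i ≢ j → Empty (K ∩ PointsOf (Ψ i) ∩ PointsOf (Ψ j))
        independent : ∀ {p q r} → p ∈ K → q ∈ K → r ∈ K →
                      ¬ (p ∼ q) → ¬ (p ∼ r) → ¬ (q ∼ r) →
                      (∀ i → ¬ (p on Ψ i × q on Ψ i × r on Ψ i)) →
                      LinearlyIndependent (coords p ∷ coords q ∷ coords r ∷ [])

    IsRegularParc : (n m h : ℕ) → Pred Point ℓ → Set (c ⊔ ℓ₁ ⊔ ℓ₂ ⊔ ℓ)
    IsRegularParc n m h K =
      m ≤ suc n ×
      Σ (Pencil n) λ pencil → ∃[ hs ] ∃[ k ]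
        ( IsParc pencil hs k K
        × (∀ i → toℕ i < m → hs i ≡ h)
        × (∀ i → m ≤ toℕ i → hs i ≡ 0))

  -- A finite set of points, being the set of points equal to a member of a
  -- list, is a predicate at this level.
  RegularParc : (n m h : ℕ) → Set (Level.suc (c ⊔ ℓ₁ ⊔ ℓ₂))
  RegularParc n m h = Σ (Pred Point (c ⊔ ℓ₁ ⊔ ℓ₂)) (IsRegularParc n m h)

{-# OPTIONS --safe #-}
module Submission where

-- Let F = GF(q²), with subfield GF(q) and trace T x = x + x^q from F onto
-- GF(q). For γ = 0 or 1 put g(w) = T(w)² + γ T(w), an additive map into GF(q),
-- and let K consist of
--
--     the points (1, g(w), w) for w in F, and (0, 1, w) for w with g(w) = 0.
--
-- K is a pencil arc for the lines through the vertex (0, 0, 1). Choose three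
-- points of K, with coordinates (x, y, w), and let D be the determinant of these
-- coordinates. As all x and y lie in GF(q), T(D) is the determinant of the points
-- (x, y, T(w)), which lie on the conic of the points (1, t² + γt, t), (0, 1, 0),
-- or are (0, 1, 1) if γ = 1, a point off the conic whose addition makes it a
-- hyperoval: its nucleus. So T(D) ≠ 0 when these three points are distinct. When
-- two of them coincide, the original two points are on a line through the vertex,
-- and D splits into factors that vanish only if two of the three original points
-- coincide, or all three are on that line (det-affine-aligned, det-affine≉0,
-- det-affine-infinite≉0, det-infinite≉0).
--
-- A line through the vertex contains either a fibre of g, or, for x = 0, the
-- kernel of g. So it has no point of K, or as many as the kernel has elements,
-- say h of them; and the lines that meet K number one more than the image of g,
-- which has q² / h elements. For γ = 0 the kernel of g is that of T, and h = q.
-- For γ = 1 it is the union of the fibres of T over 0 and 1, and h = 2q.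
--
-- What is left is that T has a kernel of q elements and takes the value 1. The
-- image of T lies in its kernel, as x^(q²) = x; the two sizes have the product
-- q²; and the kernel consists of roots of x^q + x, so has at most q elements.
-- Hence it has exactly q. So T has a nonzero value T(w) = t, and T(w/t) = 1, as
-- T is GF(q)-linear.

open import Defs
open import Algebra.Apartness.Bundles using (HeytingCommutativeRing; HeytingField)
import Algebra.Apartness.Properties.HeytingCommutativeRing as HeytingProperties
open import Algebra.Bundles using (CommutativeMonoid; CommutativeRing; Group; RawRing)
import Algebra.Properties.CommutativeMonoid.Sum as Summation
import Algebra.Properties.CommutativeSemiring.Exp as Exponentiation
import Algebra.Properties.Group as GroupProperties
import Algebra.Properties.Ring as RingProperties
import Algebra.Properties.Semiring.Mult as Multiplication
import Algebra.Solver.Ring as RingSolver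
open import Algebra.Solver.Ring.AlmostCommutativeRing using (fromCommutativeSemiring; _-Raw-AlmostCommutative⟶_)
import Algebra.Solver.Ring.NaturalCoefficients.Default as SemiringSolver
open import Data.Bool.Base using (Bool; true; false; _xor_; _∧_)
import Data.Bool.Properties as Bool
open import Data.Fin.Base using (Fin; zero; suc; toℕ; splitAt; join; combine; remQuot)
open import Data.Fin.Patterns using (0F; 1F; 2F)
import Data.Fin.Properties as Fin
open import Data.Nat.Base as ℕ using (ℕ; zero; suc; _≤_; _<_; z≤n; s≤s)
import Data.Nat.Properties as ℕ
open import Data.Nat.DivMod using (_/_; m*n/n≡m; /-congˡ)
open import Data.Nat.Divisibility using (_∣_; ∣1⇒≡1)
open import Data.Nat.Primality using (Prime; prime[2]; euclidsLemma; prime⇒irreducible)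
open import Data.Fin.Permutation using (Permutation; permutation)
open import Data.Maybe.Base as Maybe using (Maybe)
open import Data.Unit.Base using (⊤)
open import Data.Vec.Base using (Vec)
open import Data.Vec.Functional as Vector using (Vector)
open import Data.Product.Base using (Σ; ∃; ∃-syntax; _×_; _,_; proj₁; proj₂)
open import Data.Sum.Base using (_⊎_; inj₁; inj₂; [_,_]′)
open import Data.Sum.Relation.Binary.Pointwise as Sum using (Pointwise; inj₁; inj₂; _⊎ₛ_)
open import Function.Base using (_∘_)
open import Function.Bundles using (Bijection)
open import Level using (Level; _⊔_)
open import Relation.Binary.Bundles using (Setoid)
open import Relation.Binary.Definitions using (_Respects_)
open import Relation.Binary.PropositionalEquality as ≡ using (_≡_; _≢_)
import Relation.Binary.Reasoning.Setoid as SetoidReasoning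
open import Relation.Nullary.Decidable using (Dec; yes; no; ¬?)
import Relation.Nullary.Decidable as Dec
open import Relation.Nullary.Negation using (¬_; contradiction)
open import Relation.Unary using (Pred; Decidable; _∩_)

private variable
  a ℓ b ℓ′ p : Level
  m n : ℕ

-- Counting in setoids

hasSize : (S : Setoid a ℓ) → let open Setoid S in (f : Fin n → Carrier) →
          (∀ {i j} → f i ≈ f j → i ≡ j) → (∀ x → ∃[ i ] f i ≈ x) → S HasSize n
hasSize S f inj surj = record
  { to        = f
  ; cong      = λ { ≡.refl → refl }
  ; bijective = inj , λ x → proj₁ (surj x) , λ { ≡.refl → proj₂ (surj x) }
  }
  where open Setoid S

-- The enumeration of a finite setoid and its inverse, index.
module Enumeration {S : Setoid a ℓ} (size : S HasSize n) where

  open Setoid S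

  elem : Fin n → Carrier
  elem = Bijection.to size

  elem-injective : ∀ {i j} → elem i ≈ elem j → i ≡ j
  elem-injective = Bijection.injective size

  index : Carrier → Fin n
  index x = proj₁ (Bijection.surjective size x)

  elem-index : ∀ x → elem (index x) ≈ x
  elem-index x = proj₂ (Bijection.surjective size x) ≡.refl

  index-cong : ∀ {x y} → x ≈ y → index x ≡ index y
  index-cong {x} {y} x≈y =
    elem-injective (trans (elem-index x) (trans x≈y (sym (elem-index y))))

  index-injective : ∀ {x y} → index x ≡ index y → x ≈ y
  index-injective {x} {y} eq =
    trans (sym (elem-index x)) (trans (reflexive (≡.cong elem eq)) (elem-index y))

  _≈?_ : ∀ x y → Dec (x ≈ y)
  x ≈? y = Dec.map′ index-injective index-cong (index x Fin.≟ index y)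

  any? : {P : Pred Carrier p} → P Respects _≈_ → Decidable P → Dec (∃ P)
  any? resp P? = Dec.map′ (λ (i , Pi) → elem i , Pi)
                          (λ (x , Px) → index x , resp (sym (elem-index x)) Px)
                          (Fin.any? (P? ∘ elem))

module _ {S : Setoid a ℓ} {T : Setoid b ℓ′} where
  private
    module S = Setoid S
    module T = Setoid T

  size-map : (f : S.Carrier → T.Carrier) →
             (∀ {x y} → x S.≈ y → f x T.≈ f y) → (∀ {x y} → f x T.≈ f y → x S.≈ y) →
             (∀ y → ∃[ x ] f x T.≈ y) → S HasSize n → T HasSize n
  size-map f cong inj surj size = hasSize T (f ∘ elem) (elem-injective ∘ inj)
    λ y → index (proj₁ (surj y)) , T.trans (cong (elem-index _)) (proj₂ (surj y))
    where open Enumeration size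

  size-≤ : (f : S.Carrier → T.Carrier) → (∀ {x y} → f x T.≈ f y → x S.≈ y) →
           S HasSize m → T HasSize n → m ≤ n
  size-≤ f inj sizeS sizeT = Fin.injective⇒≤ {f = λ i → index (f (Bijection.to sizeS i))}
    λ eq → Bijection.injective sizeS (inj (index-injective eq))
    where open Enumeration sizeT

  size-⊎ : S HasSize m → T HasSize n → (S ⊎ₛ T) HasSize (m ℕ.+ n)
  size-⊎ {m} {n} sizeS sizeT = hasSize (S ⊎ₛ T) (f ∘ splitAt m)
    (λ {i} {j} eq → split-injective (f-injective _ _ eq))
    λ { (inj₁ x) → join m n (inj₁ (ES.index x)) , via (inj₁ (ES.index x)) (inj₁ (ES.elem-index x))
      ; (inj₂ y) → join m n (inj₂ (ET.index y)) , via (inj₂ (ET.index y)) (inj₂ (ET.elem-index y)) }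
    where
    module ES = Enumeration sizeS
    module ET = Enumeration sizeT
    f : Fin m ⊎ Fin n → S.Carrier ⊎ T.Carrier
    f = [ inj₁ ∘ ES.elem , inj₂ ∘ ET.elem ]′
    f-injective : ∀ u v → Pointwise S._≈_ T._≈_ (f u) (f v) → u ≡ v
    f-injective (inj₁ i) (inj₁ j) (inj₁ eq) = ≡.cong inj₁ (ES.elem-injective eq)
    f-injective (inj₂ i) (inj₂ j) (inj₂ eq) = ≡.cong inj₂ (ET.elem-injective eq)
    split-injective : ∀ {i j} → splitAt m i ≡ splitAt m j → i ≡ j
    split-injective {i} {j} eq =
      ≡.trans (≡.sym (Fin.join-splitAt m n i)) (≡.trans (≡.cong (join m n) eq) (Fin.join-splitAt m n j))
    via : ∀ u {z} → Pointwise S._≈_ T._≈_ (f u) z →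
          Pointwise S._≈_ T._≈_ (f (splitAt m (join m n u))) z
    via u eq rewrite Fin.splitAt-join m n u = eq

size-unique : {S : Setoid a ℓ} → S HasSize m → S HasSize n → m ≡ n
size-unique {S = S} s t = ℕ.≤-antisym (size-≤ {T = S} (λ x → x) (λ e → e) s t)
                                      (size-≤ {T = S} (λ x → x) (λ e → e) t s)

-- The elements of a subset of Fin n, listed without repetition.
record Listing (P : Pred (Fin n) p) : Set p where
  field
    length     : ℕ
    member     : Fin length → Fin n
    injective  : ∀ {i j} → member i ≡ member j → i ≡ j
    sound      : ∀ i → P (member i)
    complete   : ∀ {k} → P k → ∃[ i ] member i ≡ k

listing : (P : Pred (Fin n) p) → Decidable P → Listing P
listing {zero} P P? = record
  { length = 0 ; member = λ () ; injective = λ { {()} } ; sound = λ () ; complete = λ { {()} } }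
listing {suc n} P P? with listing (P ∘ suc) (P? ∘ suc) | P? zero
... | L | no ¬P0 = record
  { length    = length
  ; member    = suc ∘ member
  ; injective = injective ∘ Fin.suc-injective
  ; sound     = sound
  ; complete  = λ { {zero}  P0 → contradiction P0 ¬P0
                  ; {suc k} Pk → proj₁ (complete Pk) , ≡.cong suc (proj₂ (complete Pk)) }
  }
  where open Listing L
... | L | yes P0 = record
  { length    = suc length
  ; member    = member⁺
  ; injective = injective⁺ _ _
  ; sound     = λ { zero → P0 ; (suc i) → sound i }
  ; complete  = λ { {zero}  P0 → zero , ≡.refl
                  ; {suc k} Pk → suc (proj₁ (complete Pk)) , ≡.cong suc (proj₂ (complete Pk)) }
  }
  where
  open Listing L
  member⁺ : Fin (suc length) → Fin (suc n)
  member⁺ zero    = zero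
  member⁺ (suc i) = suc (member i)
  injective⁺ : ∀ i j → member⁺ i ≡ member⁺ j → i ≡ j
  injective⁺ zero    zero    eq = ≡.refl
  injective⁺ (suc i) (suc j) eq = ≡.cong suc (injective (Fin.suc-injective eq))

module _ {S : Setoid a ℓ} {P : Pred (Setoid.Carrier S) p} (resp : P Respects (Setoid._≈_ S)) where

  open Setoid S

  restrict-size : Decidable P → S HasSize n → ∃[ k ] restrict S P HasSize k
  restrict-size P? size = length , hasSize (restrict S P)
    (λ i → elem (member i) , sound i) (injective ∘ elem-injective)
    λ (x , Px) → let i , eq = complete (resp (sym (elem-index x)) Px) in
                 i , trans (reflexive (≡.cong elem eq)) (elem-index x)
    where
    open Enumeration size
    open Listing (listing (P ∘ elem) (P? ∘ elem))

-- The first m elements of the enumeration satisfy P, and the others do not.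
ListsFirst : {S : Setoid a ℓ} → S HasSize n → Pred (Setoid.Carrier S) p → ℕ → Set p
ListsFirst size P m = (∀ i → toℕ i < m → P (elem i)) × (∀ i → m ≤ toℕ i → ¬ P (elem i))
  where elem = Bijection.to size

partition : {S : Setoid a ℓ} {P : Pred (Setoid.Carrier S) p} → P Respects (Setoid._≈_ S) →
            Decidable P → restrict S P HasSize m → S HasSize n →
            Σ (S HasSize n) λ size → ListsFirst {S = S} size P m
partition {m = m} {n = n} {S = S} {P = P} resp P? sizeP size
  with restrict-size {S = S} {P = ¬_ ∘ P} (λ x≈y ¬Px Py → ¬Px (resp (Setoid.sym S x≈y) Py))
                     (¬? ∘ P?) size
... | k , size¬P = relabel (size-unique {S = S} sorted size)
  where
  open Setoid S
  P⊎¬P = restrict S P ⊎ₛ restrict S (¬_ ∘ P)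
  forget : Setoid.Carrier P⊎¬P → Carrier
  forget = [ proj₁ , proj₁ ]′
  forget-injective : ∀ x y → forget x ≈ forget y → Setoid._≈_ P⊎¬P x y
  forget-injective (inj₁ _)        (inj₁ _)        eq = inj₁ eq
  forget-injective (inj₁ (_ , Px)) (inj₂ (_ , ¬P)) eq = contradiction (resp eq Px) ¬P
  forget-injective (inj₂ (_ , ¬P)) (inj₁ (_ , Py)) eq = contradiction (resp (sym eq) Py) ¬P
  forget-injective (inj₂ _)        (inj₂ _)        eq = inj₂ eq
  forget-surjective : ∀ x → ∃[ y ] forget y ≈ x
  forget-surjective x with P? x
  ... | yes Px = inj₁ (x , Px) , refl
  ... | no ¬Px = inj₂ (x , ¬Px) , refl
  sorted : S HasSize (m ℕ.+ k)
  sorted = size-map {S = P⊎¬P} {T = S} forget (λ { (inj₁ eq) → eq ; (inj₂ eq) → eq })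
    (λ {x} {y} → forget-injective x y) forget-surjective
    (size-⊎ {S = restrict S P} {T = restrict S (¬_ ∘ P)} sizeP size¬P)
  first : ∀ i → toℕ i < m → P (Bijection.to sorted i)
  first i i<m rewrite Fin.splitAt-< m {k} i i<m = proj₂ (Bijection.to sizeP _)
  last : ∀ i → m ≤ toℕ i → ¬ P (Bijection.to sorted i)
  last i m≤i rewrite Fin.splitAt-≥ m {k} i m≤i = proj₂ (Bijection.to size¬P _)
  relabel : m ℕ.+ k ≡ n → Σ (S HasSize n) λ size → ListsFirst {S = S} size P m
  relabel ≡.refl = sorted , first , last

-- Fibres of group endomorphisms

-- An endomorphism f of a group, with a kernel of size h: each fibre of f is a
-- coset of the kernel.
module Fibres (G : Group a ℓ) (f : Group.Carrier G → Group.Carrier G)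
              (f-cong : ∀ {x y} → Group._≈_ G x y → Group._≈_ G (f x) (f y))
              (f-homo : ∀ x y → Group._≈_ G (f (Group._∙_ G x y)) (Group._∙_ G (f x) (f y)))
              {h : ℕ} (kernel : restrict (Group.setoid G) (λ x → Group._≈_ G (f x) (Group.ε G)) HasSize h)
              where

  open Group G
  open GroupProperties G using (∙-cancelˡ; identityʳ-unique)
  open SetoidReasoning setoid
  private module Ker = Enumeration {S = restrict setoid (λ x → f x ≈ ε)} kernel

  Image : Pred Carrier _
  Image y = ∃[ x ] f x ≈ y

  -- If ρ picks one point from each fibre meeting P, and P is a union of
  -- fibres, then P is the disjoint union of the cosets ρ i ∙ ker f.
  union-of-fibres-size : {P : Pred Carrier p} {r : ℕ} (ρ : Fin r → Carrier) →
    (∀ {i j} → f (ρ i) ≈ f (ρ j) → i ≡ j) →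
    (∀ {x} → P x → ∃[ i ] f (ρ i) ≈ f x) → (∀ {x} i → f (ρ i) ≈ f x → P x) →
    restrict setoid P HasSize (r ℕ.* h)
  union-of-fibres-size {P = P} {r = r} ρ ρ-injective covers within = hasSize (restrict setoid P)
    (λ k → point (remQuot h k) , within _ (sym (f-point (remQuot h k))))
    (λ {i} {j} eq → ≡.trans (≡.sym (Fin.combine-remQuot {r} h i))
      (≡.trans (≡.cong (λ (i , j) → combine i j) (point-injective _ _ eq)) (Fin.combine-remQuot {r} h j)))
    surj
    where
    point : Fin r × Fin h → Carrier
    point (i , j) = ρ i ∙ proj₁ (Ker.elem j)
    f-point : ∀ u → f (point u) ≈ f (ρ (proj₁ u))
    f-point (i , j) = begin
      f (ρ i ∙ proj₁ (Ker.elem j))       ≈⟨ f-homo _ _ ⟩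
      f (ρ i) ∙ f (proj₁ (Ker.elem j))   ≈⟨ ∙-congˡ (proj₂ (Ker.elem j)) ⟩
      f (ρ i) ∙ ε                        ≈⟨ identityʳ _ ⟩
      f (ρ i)                            ∎
    point-injective : ∀ u v → point u ≈ point v → u ≡ v
    point-injective u@(i , j) v@(i′ , j′) eq
      with ρ-injective (trans (sym (f-point u)) (trans (f-cong eq) (f-point v)))
    ... | ≡.refl = ≡.cong (i ,_) (Ker.elem-injective (∙-cancelˡ _ _ _ eq))
    surj : ∀ x → ∃[ k ] point (remQuot h k) ≈ proj₁ x
    surj (x , Px) with covers Px
    ... | i , fρi≈fx = combine i j , (begin
      point (remQuot h (combine i j))  ≡⟨ ≡.cong point (Fin.remQuot-combine {r} i j) ⟩
      ρ i ∙ proj₁ (Ker.elem j)         ≈⟨ ∙-congˡ (Ker.elem-index κ) ⟩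
      ρ i ∙ (ρ i ⁻¹ ∙ x)               ≈⟨ ρ∙ρ⁻¹∙x ⟩
      x                                ∎)
      where
      ρ∙ρ⁻¹∙x : ρ i ∙ (ρ i ⁻¹ ∙ x) ≈ x
      ρ∙ρ⁻¹∙x = trans (sym (assoc _ _ _)) (trans (∙-congʳ (inverseʳ _)) (identityˡ _))
      κ : ∃[ y ] f y ≈ ε
      κ = ρ i ⁻¹ ∙ x , identityʳ-unique (f (ρ i)) _ (begin
        f (ρ i) ∙ f (ρ i ⁻¹ ∙ x)   ≈⟨ f-homo _ _ ⟨
        f (ρ i ∙ (ρ i ⁻¹ ∙ x))     ≈⟨ f-cong ρ∙ρ⁻¹∙x ⟩
        f x                        ≈⟨ fρi≈fx ⟨
        f (ρ i)                    ∎)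
      j : Fin h
      j = Ker.index κ

  fibre-size : ∀ {y} → Image y → restrict setoid (λ x → f x ≈ y) HasSize h
  fibre-size (w , fw≈y) = ≡.subst (restrict setoid _ HasSize_) (ℕ.*-identityˡ h)
    (union-of-fibres-size {r = 1} (λ _ → w) (λ { {zero} {zero} _ → ≡.refl })
      (λ fx≈y → zero , trans fw≈y (sym fx≈y)) (λ _ fw≈fx → trans (sym fw≈fx) fw≈y))

  image-size*kernel-size : ∀ {r n} → restrict setoid Image HasSize r → setoid HasSize n →
                           r ℕ.* h ≡ n
  image-size*kernel-size {r} image size = size-unique {S = setoid}
    (size-map {S = restrict setoid (λ _ → ⊤)} {T = setoid} proj₁ (λ eq → eq) (λ eq → eq)
      (λ x → (x , _) , refl)
      (union-of-fibres-size {P = λ _ → ⊤} (λ i → proj₁ (proj₂ (Im.elem i)))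
        (λ {i} {j} eq → Im.elem-injective (trans (sym (rep i)) (trans eq (rep j))))
        (λ {x} _ → let i = Im.index (f x , x , refl) in
                   i , trans (rep i) (Im.elem-index (f x , x , refl)))
        _))
    size
    where
    module Im = Enumeration {S = restrict setoid Image} image
    rep : ∀ i → f (proj₁ (proj₂ (Im.elem i))) ≈ proj₁ (Im.elem i)
    rep i = proj₂ (proj₂ (Im.elem i))

-- Sums over all elements of a finite setoid

module _ (M : CommutativeMonoid b ℓ′) {S : Setoid a ℓ} (size : S HasSize n) where
  private
    module M = CommutativeMonoid M
    module S = Setoid S
  open Enumeration {S = S} size
  open Summation M using (sum; sum-cong-≋; sum-permute)

  -- Substituting a bijection f of S in a sum over S does not change the sum.
  sum-bijection : (v : S.Carrier → M.Carrier) → (∀ {x y} → x S.≈ y → v x M.≈ v y) →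
    (f f⁻¹ : S.Carrier → S.Carrier) →
    (∀ {x y} → x S.≈ y → f x S.≈ f y) → (∀ {x y} → x S.≈ y → f⁻¹ x S.≈ f⁻¹ y) →
    (∀ x → f (f⁻¹ x) S.≈ x) → (∀ x → f⁻¹ (f x) S.≈ x) →
    sum (v ∘ elem) M.≈ sum (v ∘ f ∘ elem)
  sum-bijection v v-cong f f⁻¹ f-cong f⁻¹-cong ff⁻¹ f⁻¹f =
    M.trans (sum-permute (v ∘ elem) π) (sum-cong-≋ λ i → v-cong (elem-index (f (elem i))))
    where
    inv : (f f⁻¹ : S.Carrier → S.Carrier) → (∀ {x y} → x S.≈ y → f x S.≈ f y) →
          (∀ x → f (f⁻¹ x) S.≈ x) → ∀ i → index (f (elem (index (f⁻¹ (elem i))))) ≡ i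
    inv f f⁻¹ f-cong ff⁻¹ i = elem-injective
      (S.trans (elem-index _) (S.trans (f-cong (elem-index _)) (ff⁻¹ _)))
    π : Permutation _ _
    π = permutation (λ i → index (f (elem i))) (λ i → index (f⁻¹ (elem i)))
          (inv f f⁻¹ f-cong ff⁻¹) (inv f⁻¹ f f⁻¹-cong f⁻¹f)

module _ (M : CommutativeMonoid b ℓ′) where
  open CommutativeMonoid M
  open Summation M using (sum; sum-cong-≋; sum-remove; sum-replicate-zero)

  sum-single : (t : Fin n → Carrier) (i : Fin n) → (∀ {j} → j ≢ i → t j ≈ ε) → sum t ≈ t i
  sum-single {n = suc n} t i rest = trans (sum-remove t)
    (trans (∙-congˡ (trans (sum-cong-≋ λ j → rest (Fin.punchInᵢ≢i i j)) (sum-replicate-zero n)))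
           (identityʳ (t i)))

-- Finite fields

-- A Heyting field F with N elements. Its equality is decidable, so that nonzero
-- elements, x ≉0, can replace elements apart from 0.
module FiniteField {c ℓ₁ ℓ₂ : Level} (F : HeytingField c ℓ₁ ℓ₂) {N : ℕ} (order : HasOrder F N) where

  open HeytingField F public using (Carrier; _#_; tight; #⇒invertible; heytingCommutativeRing)
  open HeytingCommutativeRing heytingCommutativeRing public using (commutativeRing)
  open CommutativeRing commutativeRing public hiding (Carrier; zero)
  open Enumeration {S = setoid} order public
  open HeytingProperties heytingCommutativeRing public using (1#0; x-0≈x; invertibleˡ⇒#)
  open Exponentiation commutativeSemiring public
  open RingProperties ring using ([y-z]x≈yx-zx; x∙y⁻¹≈ε⇒x≈y)
  open Multiplication semiring public using () renaming (_×_ to _·_; ×1-homo-* to ·1-homo-*)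
  open Vec
  open SetoidReasoning setoid

  infix 4 _≉0
  _≉0 : Carrier → Set ℓ₁
  x ≉0 = ¬ (x ≈ 0#)

  inverse : ∀ {x} → x ≉0 → ∃[ y ] y * x ≈ 1#
  inverse {x} x≉0 with any? (λ y≈z yx≈1 → trans (*-congʳ (sym y≈z)) yx≈1) (λ y → (y * x) ≈? 1#)
  ... | yes y = y
  -- Without an inverse x would not be apart from 0, and so, by tightness, equal to 0.
  ... | no ∄y = contradiction (proj₁ (tight x 0#) λ x#0 → let y , yx≈1 , _ = #⇒invertible x#0 in
                  ∄y (y , trans (*-congˡ (sym (x-0≈x x))) yx≈1)) x≉0

  ≉0⇒#0 : ∀ {x} → x ≉0 → x # 0#
  ≉0⇒#0 {x} x≉0 = let y , yx≈1 = inverse x≉0 in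
    invertibleˡ⇒# (y , trans (*-congˡ (x-0≈x x)) yx≈1)

  #0⇒≉0 : ∀ {x} → x # 0# → x ≉0
  #0⇒≉0 {x} x#0 x≈0 = proj₂ (tight x 0#) x≈0 x#0

  1≉0 : 1# ≉0
  1≉0 = #0⇒≉0 1#0

  integral : ∀ {x y} → x ≉0 → x * y ≈ 0# → y ≈ 0#
  integral {x} {y} x≉0 xy≈0 = let x⁻¹ , x⁻¹x≈1 = inverse x≉0 in begin
    y               ≈⟨ *-identityˡ y ⟨
    1# * y          ≈⟨ *-congʳ x⁻¹x≈1 ⟨
    x⁻¹ * x * y     ≈⟨ *-assoc _ _ _ ⟩
    x⁻¹ * (x * y)   ≈⟨ *-congˡ xy≈0 ⟩
    x⁻¹ * 0#        ≈⟨ zeroʳ _ ⟩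
    0#              ∎

  ≉0-* : ∀ {x y} → x ≉0 → y ≉0 → x * y ≉0
  ≉0-* x≉0 y≉0 xy≈0 = y≉0 (integral x≉0 xy≈0)

  cancel : ∀ {x y z} → ¬ x ≈ y → x * z ≈ y * z → z ≈ 0#
  cancel {x} {y} {z} x≉y xz≈yz = integral (x≉y ∘ x∙y⁻¹≈ε⇒x≈y x y) (begin
    (x - y) * z     ≈⟨ [y-z]x≈yx-zx z x y ⟩
    x * z - y * z   ≈⟨ +-congʳ xz≈yz ⟩
    y * z - y * z   ≈⟨ -‿inverseʳ _ ⟩
    0#              ∎)

  -- The value at x of a monic polynomial of degree n, which is given by its n
  -- other coefficients, constant coefficient first.
  ⟦_⟧ : Vec Carrier n → Carrier → Carrier
  ⟦ []     ⟧ x = 1#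
  ⟦ c ∷ cs ⟧ x = c + x * ⟦ cs ⟧ x

  -- The factor theorem P(x) - P(a) = (x - a) Q(x), without subtraction.
  factor : (cs : Vec Carrier (suc n)) (a : Carrier) → Σ (Vec Carrier n) λ ds →
           ∀ x → ⟦ cs ⟧ x + a * ⟦ ds ⟧ x ≈ ⟦ cs ⟧ a + x * ⟦ ds ⟧ x
  factor (c ∷ []) a = [] , λ x →
    solve 3 (λ c x a → c :+ x :* con 1 :+ a :* con 1 := c :+ a :* con 1 :+ x :* con 1) refl c x a
    where open SemiringSolver commutativeSemiring using (solve; con; _:=_; _:+_; _:*_)
  factor (c ∷ cs@(_ ∷ _)) a = let ds , eq = factor cs a in ⟦ cs ⟧ a ∷ ds , λ x → begin
    c + x * ⟦ cs ⟧ x + a * (⟦ cs ⟧ a + x * ⟦ ds ⟧ x)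
      ≈⟨ solve 6 (λ c x a p r d → c :+ x :* p :+ a :* (r :+ x :* d) := c :+ a :* r :+ x :* (p :+ a :* d))
               refl c x a (⟦ cs ⟧ x) (⟦ cs ⟧ a) (⟦ ds ⟧ x) ⟩
    c + a * ⟦ cs ⟧ a + x * (⟦ cs ⟧ x + a * ⟦ ds ⟧ x)
      ≈⟨ +-congˡ (*-congˡ (eq x)) ⟩
    c + a * ⟦ cs ⟧ a + x * (⟦ cs ⟧ a + x * ⟦ ds ⟧ x) ∎
    where open SemiringSolver commutativeSemiring using (solve; con; _:=_; _:+_; _:*_)

  roots-≤-degree : (cs : Vec Carrier n) (ρ : Fin m → Carrier) → (∀ {i j} → ρ i ≈ ρ j → i ≡ j) →
                   (∀ i → ⟦ cs ⟧ (ρ i) ≈ 0#) → m ≤ n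
  roots-≤-degree {m = zero}  cs ρ inj root = z≤n
  roots-≤-degree {m = suc m} [] ρ inj root = contradiction (root zero) 1≉0
  roots-≤-degree {m = suc m} cs@(_ ∷ _) ρ inj root = let ds , eq = factor cs (ρ zero) in
    s≤s (roots-≤-degree ds (ρ ∘ suc) (Fin.suc-injective ∘ inj) λ i →
      cancel (λ ρ0≈ρi → contradiction (inj ρ0≈ρi) λ ()) (begin
        ρ zero * ⟦ ds ⟧ (ρ (suc i))                            ≈⟨ +-identityˡ _ ⟨
        0# + ρ zero * ⟦ ds ⟧ (ρ (suc i))                       ≈⟨ +-congʳ (root (suc i)) ⟨
        ⟦ cs ⟧ (ρ (suc i)) + ρ zero * ⟦ ds ⟧ (ρ (suc i))       ≈⟨ eq _ ⟩
        ⟦ cs ⟧ (ρ zero) + ρ (suc i) * ⟦ ds ⟧ (ρ (suc i))       ≈⟨ +-congʳ (root zero) ⟩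
        0# + ρ (suc i) * ⟦ ds ⟧ (ρ (suc i))                    ≈⟨ +-identityˡ _ ⟩
        ρ (suc i) * ⟦ ds ⟧ (ρ (suc i))                         ∎))

  -- Translation by 1 permutes F, so does not change the sum of all elements;
  -- but it adds N · 1#.
  N·1≈0 : N · 1# ≈ 0#
  N·1≈0 = identityʳ-unique Σx (N · 1#) (begin
    Σx + N · 1#               ≈⟨ +-congˡ (sum-replicate N) ⟨
    Σx + sum {N} (λ _ → 1#)   ≈⟨ ∑-distrib-+ elem (λ _ → 1#) ⟨
    sum (λ i → elem i + 1#)   ≈⟨ sum-bijection +-commutativeMonoid {S = setoid} order (λ x → x) (λ eq → eq)
                                   (_+ 1#) (_- 1#) +-congʳ +-congʳ
                                   (λ x → trans (+-assoc _ _ _) (trans (+-congˡ (-‿inverseˡ 1#)) (+-identityʳ x)))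
                                   (λ x → trans (+-assoc _ _ _) (trans (+-congˡ (-‿inverseʳ 1#)) (+-identityʳ x))) ⟨
    Σx                        ∎)
    where
    open Summation +-commutativeMonoid using (sum; sum-replicate; ∑-distrib-+)
    open GroupProperties +-group using (identityʳ-unique)
    Σx = sum elem

  private
    open Summation *-commutativeMonoid using ()
      renaming (sum to Π; sum-cong-≋ to Π-cong; sum-replicate to Π-replicate; ∑-distrib-+ to Π-distrib)

    Π≉0 : (t : Fin n → Carrier) → (∀ i → t i ≉0) → Π t ≉0
    Π≉0 {zero}  t t≉0 = 1≉0
    Π≉0 {suc n} t t≉0 = ≉0-* (t≉0 zero) (Π≉0 (t ∘ suc) (t≉0 ∘ suc))

    -- u if x is 0, and v otherwise.
    at0 : ∀ {x} → Dec (x ≈ 0#) → Carrier → Carrier → Carrier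
    at0 (yes _) u v = u
    at0 (no  _) u v = v

    at0-yes : ∀ {x u v} (d : Dec (x ≈ 0#)) → x ≈ 0# → at0 d u v ≈ u
    at0-yes (yes _)   x≈0 = refl
    at0-yes (no  x≉0) x≈0 = contradiction x≈0 x≉0

    at0-no : ∀ {x u v} (d : Dec (x ≈ 0#)) → x ≉0 → at0 d u v ≈ v
    at0-no (yes x≈0) x≉0 = contradiction x≈0 x≉0
    at0-no (no  _)   x≉0 = refl

  -- For x ≉0, multiplication by x permutes the nonzero elements. Products are
  -- taken over all of F instead, of the function unit, which replaces 0 by 1,
  -- and of δ, which is x at 0 and 1 elsewhere. As δ y * unit (x * y) ≈ x * unit y,
  -- multiplying over all y shows that the product P of all unit y satisfies
  -- x * P ≈ x ^ N * P.
  x^N≈x : ∀ x → x ^ N ≈ x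
  x^N≈x x with x ≈? 0#
  ... | yes x≈0 = trans (0^ (index 0#)) (sym x≈0)
    where
    0^ : ∀ {n} → Fin n → x ^ n ≈ 0#
    0^ {suc n} _ = trans (*-congʳ x≈0) (zeroˡ _)
  ... | no  x≉0 = x∙y⁻¹≈ε⇒x≈y _ _ (integral P≉0 (begin
    P * (x ^ N - x)        ≈⟨ x[y-z]≈xy-xz P (x ^ N) x ⟩
    P * x ^ N - P * x      ≈⟨ +-congʳ (trans (*-comm P _) (trans x^N*P≈x*P (*-comm x P))) ⟩
    P * x - P * x          ≈⟨ -‿inverseʳ _ ⟩
    0#                     ∎))
    where
    open RingProperties ring using (x[y-z]≈xy-xz)
    unit δ : Carrier → Carrier
    unit y = at0 (y ≈? 0#) 1# y
    δ    y = at0 (y ≈? 0#) x 1#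
    P : Carrier
    P = Π (unit ∘ elem)

    unit≉0 : ∀ y → unit y ≉0
    unit≉0 y with y ≈? 0#
    ... | yes _   = 1≉0
    ... | no  y≉0 = y≉0

    P≉0 : P ≉0
    P≉0 = Π≉0 (unit ∘ elem) (unit≉0 ∘ elem)

    unit-cong : ∀ {y z} → y ≈ z → unit y ≈ unit z
    unit-cong {y} {z} y≈z with y ≈? 0#
    ... | yes y≈0 = sym (at0-yes (z ≈? 0#) (trans (sym y≈z) y≈0))
    ... | no  y≉0 = trans y≈z (sym (at0-no (z ≈? 0#) (y≉0 ∘ trans y≈z)))

    pointwise : ∀ y → δ y * unit (x * y) ≈ x * unit y
    pointwise y with y ≈? 0#
    ... | yes y≈0 = *-congˡ (at0-yes ((x * y) ≈? 0#) (trans (*-congˡ y≈0) (zeroʳ x)))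
    ... | no  y≉0 = trans (*-identityˡ _) (at0-no ((x * y) ≈? 0#) (≉0-* x≉0 y≉0))

    Πδ≈x : Π (δ ∘ elem) ≈ x
    Πδ≈x = trans (sum-single *-commutativeMonoid (δ ∘ elem) (index 0#) λ j≢i →
                    at0-no (_ ≈? 0#) λ ej≈0 → j≢i (elem-injective (trans ej≈0 (sym (elem-index 0#)))))
                 (at0-yes (_ ≈? 0#) (elem-index 0#))

    x⁻¹ : Carrier
    x⁻¹ = proj₁ (inverse x≉0)
    x⁻¹x≈1 : x⁻¹ * x ≈ 1#
    x⁻¹x≈1 = proj₂ (inverse x≉0)

    x^N*P≈x*P : x ^ N * P ≈ x * P
    x^N*P≈x*P = begin
      x ^ N * P                                ≈⟨ *-congʳ (Π-replicate N) ⟨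
      Π {N} (λ _ → x) * P                      ≈⟨ Π-distrib (λ _ → x) (unit ∘ elem) ⟨
      Π (λ i → x * unit (elem i))              ≈⟨ Π-cong (pointwise ∘ elem) ⟨
      Π (λ i → δ (elem i) * unit (x * elem i)) ≈⟨ Π-distrib (δ ∘ elem) (unit ∘ (x *_) ∘ elem) ⟩
      Π (δ ∘ elem) * Π (unit ∘ (x *_) ∘ elem)  ≈⟨ *-cong Πδ≈x (sym (sum-bijection *-commutativeMonoid {S = setoid} order
                                                    unit unit-cong (x *_) (x⁻¹ *_) *-congˡ *-congˡ
                                                    (λ y → trans (sym (*-assoc _ _ _)) (trans (*-congʳ (trans (*-comm _ _) x⁻¹x≈1)) (*-identityˡ y)))
                                                    (λ y → trans (sym (*-assoc _ _ _)) (trans (*-congʳ x⁻¹x≈1) (*-identityˡ y))))) ⟩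
      x * P                                    ∎

-- Characteristic two

-- A solver for the identities of commutative rings of characteristic two:
-- coefficients are integers modulo 2, and x is its own negative.
module CharacteristicTwoSolver {c ℓ} (R : CommutativeRing c ℓ)
  (1+1≈0 : CommutativeRing._≈_ R (CommutativeRing._+_ R (CommutativeRing.1# R) (CommutativeRing.1# R))
                                 (CommutativeRing.0# R))
  where

  open CommutativeRing R
  private
    𝔽₂ : RawRing _ _
    𝔽₂ = record { Carrier = Bool ; _≈_ = _≡_ ; _+_ = _xor_ ; _*_ = _∧_ ; -_ = λ x → x ; 0# = false ; 1# = true }

    embed : Bool → Carrier
    embed false = 0#
    embed true  = 1#

    embed-+ : ∀ x y → embed (x xor y) ≈ embed x + embed y
    embed-+ false y     = sym (+-identityˡ _)
    embed-+ true  false = sym (+-identityʳ _)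
    embed-+ true  true  = sym 1+1≈0

    embed-* : ∀ x y → embed (x ∧ y) ≈ embed x * embed y
    embed-* false y = sym (zeroˡ _)
    embed-* true  y = sym (*-identityˡ _)

    morphism : 𝔽₂ -Raw-AlmostCommutative⟶ fromCommutativeSemiring commutativeSemiring
    morphism = record
      { ⟦_⟧ = embed ; +-homo = embed-+ ; *-homo = embed-* ; -‿homo = λ _ → refl ; 0-homo = refl ; 1-homo = refl }

    _≟_ : ∀ x y → Maybe (embed x ≈ embed y)
    x ≟ y = Maybe.map (reflexive ∘ ≡.cong embed) (Dec.dec⇒maybe (x Bool.≟ y))

  open RingSolver 𝔽₂ (fromCommutativeSemiring commutativeSemiring) morphism _≟_ public
    using (solve; _:=_; _:+_; _:*_; _:^_; con)

-- A field F with q² elements, where q = 2^(e+1).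
module QuadraticExtension {c ℓ₁ ℓ₂ : Level} (F : HeytingField c ℓ₁ ℓ₂) {N : ℕ} (order : HasOrder F N)
                          (e : ℕ) (N≡q² : N ≡ (2 ℕ.^ suc e) ℕ.* (2 ℕ.^ suc e)) where

  open FiniteField F order public
  open Vec
  open SetoidReasoning setoid

  q : ℕ
  q = 2 ℕ.^ suc e

  2≤q : 2 ≤ q
  2≤q = ℕ.*-monoʳ-≤ 2 (ℕ.m^n>0 2 e)

  -- N is a power of two, and N · 1# ≈ 0#.
  1+1≈0 : 1# + 1# ≈ 0#
  1+1≈0 with (2 · 1#) ≈? 0#
  ... | yes 2·1≈0 = trans (+-congˡ (sym (+-identityʳ 1#))) 2·1≈0
  ... | no  2·1≉0 = contradiction
    (trans (sym (·1-homo-* q q)) (≡.subst (λ n → n · 1# ≈ 0#) N≡q² N·1≈0))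
    (≉0-* (2^k·1≉0 (suc e)) (2^k·1≉0 (suc e)))
    where
    2^k·1≉0 : ∀ k → (2 ℕ.^ k) · 1# ≉0
    2^k·1≉0 zero    1·1≈0 = 1≉0 (trans (sym (+-identityʳ 1#)) 1·1≈0)
    2^k·1≉0 (suc k) eq    = ≉0-* 2·1≉0 (2^k·1≉0 k) (trans (sym (·1-homo-* 2 (2 ℕ.^ k))) eq)

  open CharacteristicTwoSolver commutativeRing 1+1≈0

  x+x≈0 : ∀ x → x + x ≈ 0#
  x+x≈0 = solve 1 (λ x → x :+ x := con false) refl

  x+y≈0⇒x≈y : ∀ {x y} → x + y ≈ 0# → x ≈ y
  x+y≈0⇒x≈y {x} {y} x+y≈0 = begin
    x           ≈⟨ solve 2 (λ x y → x := x :+ y :+ y) refl x y ⟩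
    x + y + y   ≈⟨ +-congʳ x+y≈0 ⟩
    0# + y      ≈⟨ +-identityˡ y ⟩
    y           ∎

  x≈y⇒x+y≈0 : ∀ {x y} → x ≈ y → x + y ≈ 0#
  x≈y⇒x+y≈0 x≈y = trans (+-congʳ x≈y) (x+x≈0 _)

  frobenius-+ : ∀ k x y → (x + y) ^ (2 ℕ.^ k) ≈ x ^ (2 ℕ.^ k) + y ^ (2 ℕ.^ k)
  frobenius-+ zero    x y = solve 2 (λ x y → (x :+ y) :^ 1 := x :^ 1 :+ y :^ 1) refl x y
  frobenius-+ (suc k) x y = begin
    (x + y) ^ (2 ℕ.* 2 ℕ.^ k)                         ≈⟨ ^-assocʳ (x + y) 2 (2 ℕ.^ k) ⟨
    ((x + y) ^ 2) ^ (2 ℕ.^ k)                         ≈⟨ ^-congˡ (2 ℕ.^ k) (solve 2 (λ x y →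
                                                           (x :+ y) :^ 2 := x :^ 2 :+ y :^ 2) refl x y) ⟩
    (x ^ 2 + y ^ 2) ^ (2 ℕ.^ k)                       ≈⟨ frobenius-+ k (x ^ 2) (y ^ 2) ⟩
    (x ^ 2) ^ (2 ℕ.^ k) + (y ^ 2) ^ (2 ℕ.^ k)         ≈⟨ +-cong (^-assocʳ x 2 (2 ℕ.^ k)) (^-assocʳ y 2 (2 ℕ.^ k)) ⟩
    x ^ (2 ℕ.* 2 ℕ.^ k) + y ^ (2 ℕ.* 2 ℕ.^ k)         ∎

  -- The subfield GF(q) and the trace

  -- The elements of GF(q).
  Fixed : Pred Carrier ℓ₁
  Fixed x = x ^ q ≈ x

  fixed-0 : Fixed 0#
  fixed-0 = 0^ 2≤q
    where
    0^ : ∀ {n} → 2 ≤ n → 0# ^ n ≈ 0#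
    0^ (s≤s _) = zeroˡ _

  1^ : ∀ n → 1# ^ n ≈ 1#
  1^ zero    = refl
  1^ (suc n) = trans (*-identityˡ _) (1^ n)

  fixed-1 : Fixed 1#
  fixed-1 = 1^ q

  fixed-+ : ∀ {x y} → Fixed x → Fixed y → Fixed (x + y)
  fixed-+ {x} {y} fx fy = trans (frobenius-+ (suc e) x y) (+-cong fx fy)

  fixed-* : ∀ {x y} → Fixed x → Fixed y → Fixed (x * y)
  fixed-* {x} {y} fx fy = trans (^-distrib-* x y q) (*-cong fx fy)

  fixed-inverse : ∀ {x y} → y * x ≈ 1# → Fixed x → Fixed y
  fixed-inverse {x} {y} yx≈1 fx = begin
    y ^ q                   ≈⟨ *-identityʳ _ ⟨
    y ^ q * 1#              ≈⟨ *-congˡ (trans (*-comm x y) yx≈1) ⟨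
    y ^ q * (x * y)         ≈⟨ *-assoc _ _ _ ⟨
    y ^ q * x * y           ≈⟨ *-congʳ (*-congˡ fx) ⟨
    y ^ q * x ^ q * y       ≈⟨ *-congʳ (^-distrib-* y x q) ⟨
    (y * x) ^ q * y         ≈⟨ *-congʳ (trans (^-congˡ q yx≈1) (1^ q)) ⟩
    1# * y                  ≈⟨ *-identityˡ y ⟩
    y                       ∎

  -- The trace from F to GF(q).
  T : Carrier → Carrier
  T x = x + x ^ q

  T-cong : ∀ {x y} → x ≈ y → T x ≈ T y
  T-cong x≈y = +-cong x≈y (^-congˡ q x≈y)

  T-+ : ∀ x y → T (x + y) ≈ T x + T y
  T-+ x y = trans (+-congˡ (frobenius-+ (suc e) x y))
    (solve 4 (λ x y u v → x :+ y :+ (u :+ v) := x :+ u :+ (y :+ v)) refl x y (x ^ q) (y ^ q))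

  T-* : ∀ {x} → Fixed x → ∀ y → T (x * y) ≈ x * T y
  T-* {x} fx y = trans (+-congˡ (trans (^-distrib-* x y q) (*-congʳ fx))) (sym (distribˡ x y (y ^ q)))

  T-0 : T 0# ≈ 0#
  T-0 = trans (+-identityˡ _) fixed-0

  T-fixed : ∀ x → Fixed (T x)
  T-fixed x = begin
    (x + x ^ q) ^ q          ≈⟨ frobenius-+ (suc e) x (x ^ q) ⟩
    x ^ q + (x ^ q) ^ q      ≈⟨ +-congˡ (^-assocʳ x q q) ⟩
    x ^ q + x ^ (q ℕ.* q)    ≡⟨ ≡.cong (λ n → x ^ q + x ^ n) N≡q² ⟨
    x ^ q + x ^ N            ≈⟨ +-congˡ (x^N≈x x) ⟩
    x ^ q + x                ≈⟨ +-comm _ _ ⟩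
    x + x ^ q                ∎

  fixed⇒T≈0 : ∀ {x} → Fixed x → T x ≈ 0#
  fixed⇒T≈0 {x} fx = trans (+-congˡ fx) (x+x≈0 x)

  Ker : (Carrier → Carrier) → Pred Carrier ℓ₁
  Ker f x = f x ≈ 0#

  -- The kernel consists of roots of a polynomial of degree q.
  ker-T-≤ : ∀ {h} → restrict setoid (Ker T) HasSize h → h ≤ q
  ker-T-≤ ker = let cs , eq = coefficients 2≤q in
    roots-≤-degree cs (λ i → proj₁ (Bijection.to ker i)) (Bijection.injective ker)
      λ i → trans (eq _) (proj₂ (Bijection.to ker i))
    where
    zeros : ∀ n → Σ (Vec Carrier n) λ cs → ∀ x → ⟦ cs ⟧ x ≈ x ^ n
    zeros zero    = [] , λ x → refl
    zeros (suc n) = let cs , eq = zeros n in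
      0# ∷ cs , λ x → trans (+-identityˡ _) (*-congˡ (eq x))
    coefficients : ∀ {n} → 2 ≤ n → Σ (Vec Carrier n) λ cs → ∀ x → ⟦ cs ⟧ x ≈ x + x ^ n
    coefficients {suc (suc n)} (s≤s (s≤s z≤n)) = let cs , eq = zeros n in
      0# ∷ 1# ∷ cs , λ x → trans (+-identityˡ _) (trans (*-congˡ (+-congˡ (*-congˡ (eq x))))
        (trans (distribˡ x 1# _) (+-congʳ (*-identityʳ x))))

  -- As the image lies in the kernel, its size r is at most h, and h is at most q;
  -- with r * h = q², this leaves h = q only.
  ker-T-size : restrict setoid (Ker T) HasSize q
  ker-T-size = ≡.subst (restrict setoid (Ker T) HasSize_) h≡q ker
    where
    h,ker = restrict-size {S = setoid} {P = Ker T} (λ x≈y Tx≈0 → trans (T-cong (sym x≈y)) Tx≈0)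
              (λ x → T x ≈? 0#) order
    h = proj₁ h,ker
    ker = proj₂ h,ker
    open Fibres +-group T T-cong T-+ ker
    r,image = restrict-size {S = setoid} {P = Image} (λ y≈z (x , Tx≈y) → x , trans Tx≈y y≈z)
                (λ y → any? (λ w≈x Tw≈y → trans (T-cong (sym w≈x)) Tw≈y) (λ x → T x ≈? y)) order
    r = proj₁ r,image
    r≤h : r ≤ h
    r≤h = size-≤ {S = restrict setoid Image} {T = restrict setoid (Ker T)}
      (λ (y , x , Tx≈y) → y , trans (T-cong (sym Tx≈y)) (fixed⇒T≈0 (T-fixed x))) (λ eq → eq) (proj₂ r,image) ker
    r*h≡q² : r ℕ.* h ≡ q ℕ.* q
    r*h≡q² = ≡.trans (image-size*kernel-size (proj₂ r,image) order) N≡q²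
    h≡q : h ≡ q
    h≡q = ℕ.≤-antisym (ker-T-≤ ker) (ℕ.≮⇒≥ λ h<q →
      ℕ.<⇒≢ (ℕ.≤-<-trans (ℕ.*-monoˡ-≤ h r≤h) (ℕ.*-mono-< h<q h<q)) r*h≡q²)

  -- T is not zero, having a kernel of only q elements, and a nonzero value T w is
  -- an element of GF(q), by which w can be divided as T is GF(q)-linear.
  trace-1 : ∃[ w ] T w ≈ 1#
  trace-1 with any? (λ x≈y Tx≉0 Ty≈0 → Tx≉0 (trans (T-cong x≈y) Ty≈0)) (λ x → ¬? (T x ≈? 0#))
  ... | yes (w , Tw≉0) = let y , yTw≈1 = inverse Tw≉0 in
    y * w , trans (T-* (fixed-inverse yTw≈1 (T-fixed w)) w) yTw≈1
  ... | no ∄ = contradiction q²≤q (ℕ.<⇒≱ (ℕ.m<m*n q q {{ℕ.>-nonZero (ℕ.<⇒≤ 2≤q)}} 2≤q))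
    where
    q²≤q : q ℕ.* q ≤ q
    q²≤q = ≡.subst (_≤ q) N≡q² (size-≤ {S = setoid} {T = restrict setoid (Ker T)}
      (λ x → x , Dec.decidable-stable (T x ≈? 0#) (λ Tx≉0 → ∄ (x , Tx≉0))) (λ eq → eq) order ker-T-size)

  -- The additive maps T² and T² + T

  module Quadratic (γ : Carrier) (γ≈0⊎γ≈1 : γ ≈ 0# ⊎ γ ≈ 1#) where

    -- T followed by the additive map t ↦ t² + γt, which is 0 only at 0 and γ.
    g : Carrier → Carrier
    g x = T x * T x + γ * T x

    T⇒g-cong : ∀ {x y} → T x ≈ T y → g x ≈ g y
    T⇒g-cong Tx≈Ty = +-cong (*-cong Tx≈Ty Tx≈Ty) (*-congˡ Tx≈Ty)

    g-cong : ∀ {x y} → x ≈ y → g x ≈ g y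
    g-cong = T⇒g-cong ∘ T-cong

    g-+ : ∀ x y → g (x + y) ≈ g x + g y
    g-+ x y = trans (+-cong (*-cong (T-+ x y) (T-+ x y)) (*-congˡ (T-+ x y)))
      (solve 3 (λ γ t u → (t :+ u) :* (t :+ u) :+ γ :* (t :+ u) := t :* t :+ γ :* t :+ (u :* u :+ γ :* u))
             refl γ (T x) (T y))

    g-fixed : ∀ x → Fixed (g x)
    g-fixed x = fixed-+ (fixed-* (T-fixed x) (T-fixed x)) (fixed-* fixed-γ (T-fixed x))
      where
      fixed-γ : Fixed γ
      fixed-γ = [ (λ γ≈0 → trans (^-congˡ q γ≈0) (trans fixed-0 (sym γ≈0)))
                , (λ γ≈1 → trans (^-congˡ q γ≈1) (trans fixed-1 (sym γ≈1))) ]′ γ≈0⊎γ≈1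

    g≈0⇒T≈0⊎T≈γ : ∀ {x} → g x ≈ 0# → T x ≈ 0# ⊎ T x ≈ γ
    g≈0⇒T≈0⊎T≈γ {x} gx≈0 with T x ≈? 0#
    ... | yes Tx≈0 = inj₁ Tx≈0
    ... | no  Tx≉0 = inj₂ (x+y≈0⇒x≈y (integral Tx≉0 (trans
      (solve 2 (λ γ t → t :* (t :+ γ) := t :* t :+ γ :* t) refl γ (T x)) gx≈0)))

    T≈0⇒g≈0 : ∀ {x} → T x ≈ 0# → g x ≈ 0#
    T≈0⇒g≈0 Tx≈0 = trans (+-cong (trans (*-congʳ Tx≈0) (zeroˡ _)) (trans (*-congˡ Tx≈0) (zeroʳ γ))) (+-identityʳ 0#)

    T≈γ⇒g≈0 : ∀ {x} → T x ≈ γ → g x ≈ 0#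
    T≈γ⇒g≈0 {x} Tx≈γ = trans (solve 2 (λ γ t → t :* t :+ γ :* t := t :* (t :+ γ)) refl γ (T x))
      (trans (*-congˡ (x≈y⇒x+y≈0 Tx≈γ)) (zeroʳ _))

  module Q₀ = Quadratic 0# (inj₁ refl)
  module Q₁ = Quadratic 1# (inj₂ refl)

  ker-g₀-size : restrict setoid (Ker Q₀.g) HasSize q
  ker-g₀-size = size-map {S = restrict setoid (Ker T)} {T = restrict setoid (Ker Q₀.g)}
    (λ (x , Tx≈0) → x , Q₀.T≈0⇒g≈0 Tx≈0) (λ eq → eq) (λ eq → eq)
    (λ (x , gx≈0) → (x , [ (λ eq → eq) , (λ eq → eq) ]′ (Q₀.g≈0⇒T≈0⊎T≈γ gx≈0)) , refl) ker-T-size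

  -- The kernel of T² + T is the union of the fibres of the trace over 0 and 1.
  ker-g₁-size : restrict setoid (Ker Q₁.g) HasSize (2 ℕ.* q)
  ker-g₁-size = union-of-fibres-size ρ (λ {i} {j} → ρ-injective i j) covers
    λ { zero       Tρ≈Tx → Q₁.T≈0⇒g≈0 (trans (sym Tρ≈Tx) T-0)
      ; (suc zero) Tρ≈Tx → Q₁.T≈γ⇒g≈0 (trans (sym Tρ≈Tx) (proj₂ trace-1)) }
    where
    open Fibres +-group T T-cong T-+ ker-T-size
    ρ : Fin 2 → Carrier
    ρ zero       = 0#
    ρ (suc zero) = proj₁ trace-1
    T0≉T1 : ¬ T 0# ≈ T (proj₁ trace-1)
    T0≉T1 eq = 1≉0 (trans (sym (proj₂ trace-1)) (trans (sym eq) T-0))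
    ρ-injective : ∀ i j → T (ρ i) ≈ T (ρ j) → i ≡ j
    ρ-injective zero       zero       eq = ≡.refl
    ρ-injective zero       (suc zero) eq = contradiction eq T0≉T1
    ρ-injective (suc zero) zero       eq = contradiction (sym eq) T0≉T1
    ρ-injective (suc zero) (suc zero) eq = ≡.refl
    covers : ∀ {x} → Q₁.g x ≈ 0# → ∃[ i ] T (ρ i) ≈ T x
    covers gx≈0 with Q₁.g≈0⇒T≈0⊎T≈γ gx≈0
    ... | inj₁ Tx≈0 = zero , trans T-0 (sym Tx≈0)
    ... | inj₂ Tx≈1 = suc zero , trans (proj₂ trace-1) (sym Tx≈1)

  -- Linear independence

  open ProjectivePlane F
  open Summation +-commutativeMonoid using (sum; sum-cong-≋)

  private module H = Setoid homogeneousSetoid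

  independent-pair : ∀ {u v} → ¬ (u ∼ v) → LinearlyIndependent (coords u Vector.∷ coords v Vector.∷ Vector.[])
  independent-pair {u@(_ , i , uᵢ#0)} {v@(_ , j , vⱼ#0)} u≁v a eq = λ { zero → a₀≈0 ; (suc zero) → a₁≈0 }
    where
    a₀ a₁ : Carrier
    a₀ = a zero
    a₁ = a (suc zero)

    a₀u≈a₁v : ∀ k → a₀ * coords u k ≈ a₁ * coords v k
    a₀u≈a₁v k = x+y≈0⇒x≈y (trans (+-congˡ (sym (+-identityʳ _))) (eq k))

    a₀≈0 : a₀ ≈ 0#
    a₀≈0 with a₀ ≈? 0#
    ... | yes eq = eq
    ... | no a₀≉0 = contradiction (a₀⁻¹ * a₁ , ≉0⇒#0 a₀⁻¹a₁≉0 , u≈a₀⁻¹a₁v) u≁v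
      where
      a₀⁻¹ = proj₁ (inverse a₀≉0)
      u≈a₀⁻¹a₁v : ∀ k → coords u k ≈ a₀⁻¹ * a₁ * coords v k
      u≈a₀⁻¹a₁v k = begin
        coords u k               ≈⟨ *-identityˡ _ ⟨
        1# * coords u k          ≈⟨ *-congʳ (proj₂ (inverse a₀≉0)) ⟨
        a₀⁻¹ * a₀ * coords u k      ≈⟨ *-assoc _ _ _ ⟩
        a₀⁻¹ * (a₀ * coords u k)    ≈⟨ *-congˡ (a₀u≈a₁v k) ⟩
        a₀⁻¹ * (a₁ * coords v k)    ≈⟨ *-assoc _ _ _ ⟨
        a₀⁻¹ * a₁ * coords v k      ∎
      a₀⁻¹a₁≉0 : a₀⁻¹ * a₁ ≉0
      a₀⁻¹a₁≉0 a₀⁻¹a₁≈0 = #0⇒≉0 uᵢ#0 (trans (u≈a₀⁻¹a₁v i) (trans (*-congʳ a₀⁻¹a₁≈0) (zeroˡ _)))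

    a₁≈0 : a₁ ≈ 0#
    a₁≈0 = integral (#0⇒≉0 vⱼ#0) (trans (*-comm _ _)
      (trans (sym (a₀u≈a₁v j)) (trans (*-congʳ a₀≈0) (zeroˡ _))))

  -- The determinant with rows u, v and w. In characteristic two signs do not
  -- matter.
  det : (u v w : Vector Carrier 3) → Carrier
  det u v w = u 0F * (v 1F * w 2F + v 2F * w 1F) + u 1F * (v 0F * w 2F + v 2F * w 0F)
            + u 2F * (v 0F * w 1F + v 1F * w 0F)

  det-swap₀₁ : ∀ u v w → det u v w ≈ det v u w
  det-swap₀₁ u v w = solve 9 (λ u₀ u₁ u₂ v₀ v₁ v₂ w₀ w₁ w₂ →
      u₀ :* (v₁ :* w₂ :+ v₂ :* w₁) :+ u₁ :* (v₀ :* w₂ :+ v₂ :* w₀) :+ u₂ :* (v₀ :* w₁ :+ v₁ :* w₀)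
    := v₀ :* (u₁ :* w₂ :+ u₂ :* w₁) :+ v₁ :* (u₀ :* w₂ :+ u₂ :* w₀) :+ v₂ :* (u₀ :* w₁ :+ u₁ :* w₀))
    refl (u 0F) (u 1F) (u 2F) (v 0F) (v 1F) (v 2F) (w 0F) (w 1F) (w 2F)

  det-swap₁₂ : ∀ u v w → det u v w ≈ det u w v
  det-swap₁₂ u v w = solve 9 (λ u₀ u₁ u₂ v₀ v₁ v₂ w₀ w₁ w₂ →
      u₀ :* (v₁ :* w₂ :+ v₂ :* w₁) :+ u₁ :* (v₀ :* w₂ :+ v₂ :* w₀) :+ u₂ :* (v₀ :* w₁ :+ v₁ :* w₀)
    := u₀ :* (w₁ :* v₂ :+ w₂ :* v₁) :+ u₁ :* (w₀ :* v₂ :+ w₂ :* v₀) :+ u₂ :* (w₀ :* v₁ :+ w₁ :* v₀))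
    refl (u 0F) (u 1F) (u 2F) (v 0F) (v 1F) (v 2F) (w 0F) (w 1F) (w 2F)

  -- Cramer's rule: det u v w * a is a combination of the three coordinates of
  -- a u + b v + c w.
  det-annihilates : ∀ u v w {a b c} → det u v w ≉0 → (∀ j → a * u j + (b * v j + (c * w j + 0#)) ≈ 0#) → a ≈ 0#
  det-annihilates u v w {a} {b} {c} det≉0 eq = integral det≉0 (begin
    det u v w * a
      ≈⟨ solve 12 (λ a b c u₀ u₁ u₂ v₀ v₁ v₂ w₀ w₁ w₂ →
           (u₀ :* (v₁ :* w₂ :+ v₂ :* w₁) :+ u₁ :* (v₀ :* w₂ :+ v₂ :* w₀) :+ u₂ :* (v₀ :* w₁ :+ v₁ :* w₀)) :* a
         := (a :* u₀ :+ (b :* v₀ :+ (c :* w₀ :+ con false))) :* (v₁ :* w₂ :+ v₂ :* w₁)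
         :+ (a :* u₁ :+ (b :* v₁ :+ (c :* w₁ :+ con false))) :* (v₀ :* w₂ :+ v₂ :* w₀)
         :+ (a :* u₂ :+ (b :* v₂ :+ (c :* w₂ :+ con false))) :* (v₀ :* w₁ :+ v₁ :* w₀))
         refl a b c (u 0F) (u 1F) (u 2F) (v 0F) (v 1F) (v 2F) (w 0F) (w 1F) (w 2F) ⟩
    row 0F * (v 1F * w 2F + v 2F * w 1F) + row 1F * (v 0F * w 2F + v 2F * w 0F) + row 2F * (v 0F * w 1F + v 1F * w 0F)
      ≈⟨ +-cong (+-cong (vanish 0F) (vanish 1F)) (vanish 2F) ⟩
    0# + 0# + 0#
      ≈⟨ trans (+-identityʳ _) (+-identityʳ 0#) ⟩
    0# ∎)
    where
    row : Fin 3 → Carrier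
    row j = a * u j + (b * v j + (c * w j + 0#))
    vanish : ∀ j {x} → row j * x ≈ 0#
    vanish j = trans (*-congʳ (eq j)) (zeroˡ _)

  det≉0⇒independent : ∀ {u v w} → det u v w ≉0 → LinearlyIndependent (u Vector.∷ v Vector.∷ w Vector.∷ Vector.[])
  det≉0⇒independent {u} {v} {w} det≉0 a eq = λ
    { 0F → det-annihilates u v w det≉0 eq
    ; 1F → det-annihilates v u w (det≉0 ∘ trans (det-swap₀₁ u v w)) λ j → trans
        (solve 3 (λ x y z → y :+ (x :+ (z :+ con false)) := x :+ (y :+ (z :+ con false))) refl _ _ _) (eq j)
    ; 2F → det-annihilates w u v (det≉0 ∘ trans (trans (det-swap₁₂ u v w) (det-swap₀₁ u w v))) λ j → trans
        (solve 3 (λ x y z → z :+ (x :+ (y :+ con false)) := x :+ (y :+ (z :+ con false))) refl _ _ _) (eq j) }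

  -- Linear independence of points does not depend on the homogeneous
  -- coordinates chosen.
  independent-scale : ∀ {d} (u v : Vector (Vector Carrier d) n) →
                      (∀ i → ∃[ λ′ ] (λ′ # 0# × ∀ j → u i j ≈ λ′ * v i j)) →
                      LinearlyIndependent v → LinearlyIndependent u
  independent-scale u v scale indep a eq i = let λ′ , λ′#0 , _ = scale i in
    integral (#0⇒≉0 λ′#0) (trans (*-comm _ _) (indep (λ i → a i * proj₁ (scale i))
      (λ j → trans (sum-cong-≋ λ i → trans (*-assoc _ _ _) (*-congˡ (sym (proj₂ (proj₂ (scale i)) j)))) (eq j)) i))

  on-respects : ∀ l u v → u ∼ v → v on l → u on l
  on-respects l u v (λ′ , _ , u≈λv) v∈l = begin
    sum (λ i → coords l i * coords u i)
      ≈⟨ sum-cong-≋ (λ i → *-congˡ {coords l i} (u≈λv i)) ⟩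
    sum (λ i → coords l i * (λ′ * coords v i))
      ≈⟨ solve 7 (λ x l₀ l₁ l₂ v₀ v₁ v₂ →
           l₀ :* (x :* v₀) :+ (l₁ :* (x :* v₁) :+ (l₂ :* (x :* v₂) :+ con false))
         := x :* (l₀ :* v₀ :+ (l₁ :* v₁ :+ (l₂ :* v₂ :+ con false))))
         refl λ′ _ _ _ _ _ _ ⟩
    λ′ * sum (λ i → coords l i * coords v i)
      ≈⟨ *-congˡ v∈l ⟩
    λ′ * 0#
      ≈⟨ zeroʳ λ′ ⟩
    0# ∎

  -- The pencil of lines through (0, 0, 1)

  module _ (sorted : setoid HasSize N) where
    private module E = Enumeration {S = setoid} sorted

    centre : Point
    centre = (0# Vector.∷ 0# Vector.∷ 1# Vector.∷ Vector.[]) , 2F , 1#0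

    -- The line x = 0, then the lines y = sx for all s in F, in the given order.
    line : Fin (suc N) → Line
    line zero    = (1# Vector.∷ 0# Vector.∷ 0# Vector.∷ Vector.[]) , 0F , 1#0
    line (suc i) = (E.elem i Vector.∷ 1# Vector.∷ 0# Vector.∷ Vector.[]) , 1F , 1#0

    line-injective : ∀ i j → line i ∼ line j → i ≡ j
    line-injective zero    zero    _ = ≡.refl
    line-injective zero    (suc j) (λ′ , λ′#0 , eq) =
      contradiction (trans (sym (*-identityʳ λ′)) (sym (eq 1F))) (#0⇒≉0 λ′#0)
    line-injective (suc i) zero    (λ′ , λ′#0 , eq) =
      contradiction (trans (eq 1F) (zeroʳ λ′)) 1≉0
    line-injective (suc i) (suc j) (λ′ , λ′#0 , eq) = ≡.cong suc (E.elem-injective (begin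
      E.elem i         ≈⟨ eq 0F ⟩
      λ′ * E.elem j    ≈⟨ *-congʳ (trans (sym (*-identityʳ λ′)) (sym (eq 1F))) ⟩
      1# * E.elem j    ≈⟨ *-identityˡ _ ⟩
      E.elem j         ∎))

    line-surjective : ∀ l → centre on l → ∃[ i ] line i ∼ l
    line-surjective l@(v , i₀ , v#0) centre∈l with v 1F ≈? 0#
    ... | yes v₁≈0 = zero , H.sym {l} {line zero} (v 0F , ≉0⇒#0 (v₀≉0 i₀ v#0) , λ
      { 0F → sym (*-identityʳ _)
      ; 1F → trans v₁≈0 (sym (zeroʳ _))
      ; 2F → trans v₂≈0 (sym (zeroʳ _)) })
      where
      v₂≈0 : v 2F ≈ 0#
      v₂≈0 = trans (solve 3 (λ x y z → z := x :* con false :+ (y :* con false :+ (z :* con true :+ con false)))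
                          refl (v 0F) (v 1F) (v 2F)) centre∈l
      v₀≉0 : ∀ i → v i # 0# → v 0F ≉0
      v₀≉0 0F v₀#0 = #0⇒≉0 v₀#0
      v₀≉0 1F v₁#0 = contradiction v₁≈0 (#0⇒≉0 v₁#0)
      v₀≉0 2F v₂#0 = contradiction v₂≈0 (#0⇒≉0 v₂#0)
    ... | no v₁≉0 = suc (E.index slope) , H.sym {l} {line (suc (E.index slope))} (v 1F , ≉0⇒#0 v₁≉0 , λ
      { 0F → sym (begin
          v 1F * E.elem (E.index slope)  ≈⟨ *-congˡ (E.elem-index slope) ⟩
          v 1F * (v₁⁻¹ * v 0F)              ≈⟨ solve 3 (λ x y z → x :* (y :* z) := y :* x :* z) refl (v 1F) v₁⁻¹ (v 0F) ⟩
          v₁⁻¹ * v 1F * v 0F              ≈⟨ *-congʳ (proj₂ (inverse v₁≉0)) ⟩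
          1# * v 0F                      ≈⟨ *-identityˡ _ ⟩
          v 0F                           ∎)
      ; 1F → sym (*-identityʳ _)
      ; 2F → trans v₂≈0 (sym (zeroʳ _)) })
      where
      v₂≈0 : v 2F ≈ 0#
      v₂≈0 = trans (solve 3 (λ x y z → z := x :* con false :+ (y :* con false :+ (z :* con true :+ con false)))
                          refl (v 0F) (v 1F) (v 2F)) centre∈l
      v₁⁻¹ slope : Carrier
      v₁⁻¹ = proj₁ (inverse v₁≉0)
      slope = v₁⁻¹ * v 0F

    pencil : Pencil N
    pencil = record
      { centre = centre
      ; lines  = hasSize (restrict homogeneousSetoid (centre on_))
          (λ i → line i , centre∈line i) (λ {i} {j} → line-injective i j)
          (λ (l , centre∈l) → line-surjective l centre∈l)
      }
      where
      centre∈line : ∀ i → centre on line i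
      centre∈line zero    = solve 0 (con true :* con false :+ (con false :* con false :+ (con false :* con true :+ con false)) := con false) refl
      centre∈line (suc i) = solve 1 (λ x → x :* con false :+ (con true :* con false :+ (con false :* con true :+ con false)) := con false) refl (E.elem i)

  -- The pencil arc of a quadratic map

  -- The map g for a choice of γ, with a kernel of size h.
  module PencilArc (γ : Carrier) (γ≈0⊎γ≈1 : γ ≈ 0# ⊎ γ ≈ 1#) {h : ℕ}
                   (kernel : restrict setoid (Ker (Quadratic.g γ γ≈0⊎γ≈1)) HasSize h) where

    open Quadratic γ γ≈0⊎γ≈1
    open Fibres +-group g g-cong g-+ kernel

    Image-respects : Image Respects _≈_
    Image-respects y≈z (x , gx≈y) = x , trans gx≈y y≈z

    Image? : Decidable Image
    Image? y = any? (λ w≈x gw≈y → trans (g-cong (sym w≈x)) gw≈y) (λ x → g x ≈? y)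

    -- The points of K correspond to an arbitrary w, for the point (1, g w, w), or
    -- a w in the kernel of g, for the point (0, 1, w).
    Parameter : Setoid _ _
    Parameter = setoid ⊎ₛ restrict setoid (Ker g)
    module Parameter = Setoid Parameter

    point : Parameter.Carrier → Point
    point (inj₁ w)       = (1# Vector.∷ g w Vector.∷ w Vector.∷ Vector.[]) , 0F , 1#0
    point (inj₂ (w , _)) = (0# Vector.∷ 1# Vector.∷ w Vector.∷ Vector.[]) , 1F , 1#0

    point-cong : ∀ {r s} → r Parameter.≈ s → point r ∼ point s
    point-cong (inj₁ w≈z) = 1# , 1#0 , λ
      { 0F → sym (*-identityˡ _) ; 1F → trans (g-cong w≈z) (sym (*-identityˡ _)) ; 2F → trans w≈z (sym (*-identityˡ _)) }
    point-cong (inj₂ w≈z) = 1# , 1#0 , λ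
      { 0F → sym (*-identityˡ _) ; 1F → sym (*-identityˡ _) ; 2F → trans w≈z (sym (*-identityˡ _)) }

    point-injective : ∀ r s → point r ∼ point s → r Parameter.≈ s
    point-injective (inj₁ w) (inj₁ z) (λ′ , _ , eq) = inj₁ (begin
      w         ≈⟨ eq 2F ⟩
      λ′ * z    ≈⟨ *-congʳ (trans (sym (*-identityʳ λ′)) (sym (eq 0F))) ⟩
      1# * z    ≈⟨ *-identityˡ z ⟩
      z         ∎)
    point-injective (inj₁ w) (inj₂ z) (λ′ , _ , eq) = contradiction (trans (eq 0F) (zeroʳ λ′)) 1≉0
    point-injective (inj₂ w) (inj₁ z) (λ′ , λ′#0 , eq) =
      contradiction (trans (sym (*-identityʳ λ′)) (sym (eq 0F))) (#0⇒≉0 λ′#0)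
    point-injective (inj₂ (w , _)) (inj₂ (z , _)) (λ′ , _ , eq) = inj₂ (begin
      w         ≈⟨ eq 2F ⟩
      λ′ * z    ≈⟨ *-congʳ (trans (sym (*-identityʳ λ′)) (sym (eq 1F))) ⟩
      1# * z    ≈⟨ *-identityˡ z ⟩
      z         ∎)

    -- K is closed under rescaling of homogeneous coordinates.
    K : Pred Point (c ⊔ ℓ₁ ⊔ ℓ₂)
    K p = ∃[ r ] p ∼ point r

    point∈K : ∀ r → K (point r)
    point∈K r = r , H.refl {point r}

    -- Determinants of three points of K

    vec : Parameter.Carrier → Vector Carrier 3
    vec r = coords (point r)

    det-affine : ∀ u v w → det (vec (inj₁ u)) (vec (inj₁ v)) (vec (inj₁ w)) ≈
                           (g v + g w) * u + (g u + g w) * v + (g u + g v) * w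
    det-affine u v w = solve 6 (λ u v w x y z →
        con true :* (y :* w :+ v :* z) :+ x :* (con true :* w :+ v :* con true) :+ u :* (con true :* z :+ y :* con true)
      := (y :+ z) :* u :+ (x :+ z) :* v :+ (x :+ y) :* w)
      refl u v w (g u) (g v) (g w)

    -- Of three points, the first two, but not the third, are on one line through
    -- the vertex.
    det-affine-aligned : ∀ u v w → g u ≈ g v → ¬ u ≈ v → ¬ g u ≈ g w →
                         det (vec (inj₁ u)) (vec (inj₁ v)) (vec (inj₁ w)) ≉0
    det-affine-aligned u v w gu≈gv u≉v gu≉gw det≈0 =
      ≉0-* (gu≉gw ∘ x+y≈0⇒x≈y) (u≉v ∘ x+y≈0⇒x≈y) (begin
      (g u + g w) * (u + v)
        ≈⟨ solve 6 (λ u v w x y z → (x :+ z) :* (u :+ v)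
             := (y :+ z) :* u :+ (x :+ z) :* v :+ (x :+ y) :* w :+ (x :+ y) :* (u :+ w))
             refl u v w (g u) (g v) (g w) ⟩
      (g v + g w) * u + (g u + g w) * v + (g u + g v) * w + (g u + g v) * (u + w)
        ≈⟨ +-cong (trans (sym (det-affine u v w)) det≈0) (trans (*-congʳ (x≈y⇒x+y≈0 gu≈gv)) (zeroˡ _)) ⟩
      0# + 0#
        ≈⟨ +-identityʳ 0# ⟩
      0# ∎)

    -- Points of equal trace are on a line through the vertex. If the three
    -- traces differ, the trace of the determinant is a Vandermonde
    -- determinant, for the conic points (1, t² + γt, t).
    det-affine≉0 : ∀ u v w → ¬ u ≈ v → ¬ u ≈ w → ¬ v ≈ w → ¬ (g u ≈ g v × g u ≈ g w) →
                   det (vec (inj₁ u)) (vec (inj₁ v)) (vec (inj₁ w)) ≉0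
    det-affine≉0 u v w u≉v u≉w v≉w ¬aligned with T u ≈? T v | T u ≈? T w | T v ≈? T w
    ... | yes Tu≈Tv | _ | _ = let gu≈gv = T⇒g-cong Tu≈Tv in
      det-affine-aligned u v w gu≈gv u≉v λ gu≈gw → ¬aligned (gu≈gv , gu≈gw)
    ... | no _ | yes Tu≈Tw | _ = let gu≈gw = T⇒g-cong Tu≈Tw in
      det-affine-aligned u w v gu≈gw u≉w (λ gu≈gv → ¬aligned (gu≈gv , gu≈gw))
        ∘ trans (det-swap₁₂ (vec (inj₁ u)) (vec (inj₁ w)) (vec (inj₁ v)))
    ... | no _ | no _ | yes Tv≈Tw = let gv≈gw = T⇒g-cong Tv≈Tw in
      det-affine-aligned v w u gv≈gw v≉w (λ gv≈gu → ¬aligned (sym gv≈gu , trans (sym gv≈gu) gv≈gw))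
        ∘ trans (trans (det-swap₁₂ (vec (inj₁ v)) (vec (inj₁ w)) (vec (inj₁ u)))
                       (det-swap₀₁ (vec (inj₁ v)) (vec (inj₁ u)) (vec (inj₁ w))))
    ... | no Tu≉Tv | no Tu≉Tw | no Tv≉Tw = λ det≈0 →
      ≉0-* (≉0-* (Tu≉Tv ∘ x+y≈0⇒x≈y) (Tu≉Tw ∘ x+y≈0⇒x≈y)) (Tv≉Tw ∘ x+y≈0⇒x≈y) (begin
      (T u + T v) * (T u + T w) * (T v + T w)
        ≈⟨ solve 4 (λ γ u v w → (u :+ v) :* (u :+ w) :* (v :+ w)
             := (v :* v :+ γ :* v :+ (w :* w :+ γ :* w)) :* u
             :+ (u :* u :+ γ :* u :+ (w :* w :+ γ :* w)) :* v
             :+ (u :* u :+ γ :* u :+ (v :* v :+ γ :* v)) :* w) refl γ (T u) (T v) (T w) ⟩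
      (g v + g w) * T u + (g u + g w) * T v + (g u + g v) * T w
        ≈⟨ +-cong (+-cong (T-* (fixed-+ (g-fixed v) (g-fixed w)) u) (T-* (fixed-+ (g-fixed u) (g-fixed w)) v))
                  (T-* (fixed-+ (g-fixed u) (g-fixed v)) w) ⟨
      T ((g v + g w) * u) + T ((g u + g w) * v) + T ((g u + g v) * w)
        ≈⟨ trans (T-+ _ _) (+-congʳ (T-+ _ _)) ⟨
      T ((g v + g w) * u + (g u + g w) * v + (g u + g v) * w)
        ≈⟨ T-cong (trans (sym (det-affine u v w)) det≈0) ⟩
      T 0#
        ≈⟨ T-0 ⟩
      0# ∎)

    det-affine-infinite : ∀ u v s → det (vec (inj₁ u)) (vec (inj₁ v)) (vec (inj₂ s)) ≈
                                    (g u + g v) * proj₁ s + (u + v)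
    det-affine-infinite u v (s , _) = solve 5 (λ u v s x y →
        con true :* (y :* s :+ v :* con true) :+ x :* (con true :* s :+ v :* con false)
        :+ u :* (con true :* con true :+ y :* con false)
      := (x :+ y) :* s :+ (u :+ v)) refl u v s (g u) (g v)

    -- The condition on γ enters here: it puts both (0, 1, 0) and (0, 1, γ) on
    -- an arc with the conic points (1, t² + γt, t).
    det-affine-infinite≉0 : ∀ u v s → ¬ u ≈ v → det (vec (inj₁ u)) (vec (inj₁ v)) (vec (inj₂ s)) ≉0
    det-affine-infinite≉0 u v s@(s₀ , gs≈0) u≉v det≈0 with T u ≈? T v
    ... | yes Tu≈Tv = u≉v (x+y≈0⇒x≈y (begin
      u + v                             ≈⟨ +-identityˡ _ ⟨
      0# + (u + v)                      ≈⟨ +-congʳ (trans (*-congʳ (x≈y⇒x+y≈0 (T⇒g-cong Tu≈Tv))) (zeroˡ s₀)) ⟨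
      (g u + g v) * s₀ + (u + v)        ≈⟨ trans (sym (det-affine-infinite u v s)) det≈0 ⟩
      0#                                ∎))
    ... | no Tu≉Tv = ≉0-* (Tu≉Tv ∘ x+y≈0⇒x≈y) cofactor≉0 (begin
      (T u + T v) * ((T u + T v + γ) * T s₀ + 1#)
        ≈⟨ solve 4 (λ γ u v s → (u :+ v) :* ((u :+ v :+ γ) :* s :+ con true)
             := (u :* u :+ γ :* u :+ (v :* v :+ γ :* v)) :* s :+ (u :+ v)) refl γ (T u) (T v) (T s₀) ⟩
      (g u + g v) * T s₀ + (T u + T v)
        ≈⟨ +-cong (T-* (fixed-+ (g-fixed u) (g-fixed v)) s₀) (T-+ u v) ⟨
      T ((g u + g v) * s₀) + T (u + v)
        ≈⟨ T-+ _ _ ⟨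
      T ((g u + g v) * s₀ + (u + v))
        ≈⟨ T-cong (trans (sym (det-affine-infinite u v s)) det≈0) ⟩
      T 0#
        ≈⟨ T-0 ⟩
      0# ∎)
      where
      cofactor≉0 : (T u + T v + γ) * T s₀ + 1# ≉0
      cofactor≉0 eq with T s₀ ≈? 0#
      ... | yes Ts≈0 = 1≉0 (trans (sym (trans (+-congʳ (trans (*-congˡ Ts≈0) (zeroʳ _))) (+-identityˡ 1#))) eq)
      -- Now T s₀ ≈ γ ≈ 1, and the cofactor is T u + T v.
      ... | no  Ts≉0 = Tu≉Tv (x+y≈0⇒x≈y (begin
        T u + T v                          ≈⟨ solve 2 (λ u v → u :+ v := (u :+ v :+ con true) :* con true :+ con true)
                                                refl (T u) (T v) ⟩
        (T u + T v + 1#) * 1# + 1#         ≈⟨ +-congʳ (*-cong (+-congˡ γ≈1) (trans Ts≈γ γ≈1)) ⟨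
        (T u + T v + γ) * T s₀ + 1#        ≈⟨ eq ⟩
        0#                                 ∎))
        where
        Ts≈γ : T s₀ ≈ γ
        Ts≈γ = [ (λ Ts≈0 → contradiction Ts≈0 Ts≉0) , (λ eq → eq) ]′ (g≈0⇒T≈0⊎T≈γ gs≈0)
        γ≈1 : γ ≈ 1#
        γ≈1 = [ (λ γ≈0 → contradiction (trans Ts≈γ γ≈0) Ts≉0) , (λ eq → eq) ]′ γ≈0⊎γ≈1

    det-infinite≉0 : ∀ w s t → ¬ proj₁ s ≈ proj₁ t →
                   det (vec (inj₁ w)) (vec (inj₂ s)) (vec (inj₂ t)) ≉0
    det-infinite≉0 w (s , _) (t , _) s≉t det≈0 = s≉t (x+y≈0⇒x≈y (trans
      (solve 4 (λ w s t x → s :+ t := con true :* (con true :* t :+ s :* con true)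
        :+ x :* (con false :* t :+ s :* con false) :+ w :* (con false :* con true :+ con true :* con false))
        refl w s t (g w)) det≈0))

    -- The lines through the vertex, those meeting K first

    -- The slopes of the lines y = sx that meet K are the r elements of the image.
    image-size : ∃[ r ] restrict setoid Image HasSize r
    image-size = restrict-size {S = setoid} Image-respects Image? order

    r : ℕ
    r = proj₁ image-size

    r*h≡N : r ℕ.* h ≡ N
    r*h≡N = image-size*kernel-size (proj₂ image-size) order

    slopes : Σ (setoid HasSize N) λ size → ListsFirst {S = setoid} size Image r
    slopes = partition {S = setoid} Image-respects Image? (proj₂ image-size) order

    Ψ : Fin (suc N) → Line
    Ψ = line (proj₁ slopes)

    private module E = Enumeration {S = setoid} (proj₁ slopes)

    affine-on : ∀ w i → point (inj₁ w) on Ψ (suc i) → g w ≈ E.elem i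
    affine-on w i on = x+y≈0⇒x≈y (trans
      (solve 3 (λ e x w → x :+ e := e :* con true :+ (con true :* x :+ (con false :* w :+ con false)))
        refl (E.elem i) (g w) w) on)

    on-affine : ∀ w i → g w ≈ E.elem i → point (inj₁ w) on Ψ (suc i)
    on-affine w i eq = trans
      (solve 3 (λ e x w → e :* con true :+ (con true :* x :+ (con false :* w :+ con false)) := x :+ e)
        refl (E.elem i) (g w) w) (x≈y⇒x+y≈0 eq)

    affine-not-on : ∀ w → ¬ (point (inj₁ w) on Ψ zero)
    affine-not-on w on = 1≉0 (trans
      (solve 2 (λ x w → con true := con true :* con true :+ (con false :* x :+ (con false :* w :+ con false)))
        refl (g w) w) on)

    on-infinite : ∀ s → point (inj₂ s) on Ψ zero
    on-infinite (s , _) = solve 1 (λ s →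
      con true :* con false :+ (con false :* con true :+ (con false :* s :+ con false)) := con false) refl s

    infinite-not-on : ∀ s i → ¬ (point (inj₂ s) on Ψ (suc i))
    infinite-not-on (s , _) i on = 1≉0 (trans
      (solve 2 (λ e s → con true := e :* con false :+ (con true :* con true :+ (con false :* s :+ con false)))
        refl (E.elem i) s) on)

    -- The vertex is not in K, so a point of K is on only one of the lines.
    line-unique : ∀ r i j → point r on Ψ i → point r on Ψ j → i ≡ j
    line-unique (inj₁ w) zero    _       on₁ on₂ = contradiction on₁ (affine-not-on w)
    line-unique (inj₁ w) (suc i) zero    on₁ on₂ = contradiction on₂ (affine-not-on w)
    line-unique (inj₁ w) (suc i) (suc j) on₁ on₂ =
      ≡.cong suc (E.elem-injective (trans (sym (affine-on w i on₁)) (affine-on w j on₂)))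
    line-unique (inj₂ s) zero    zero    on₁ on₂ = ≡.refl
    line-unique (inj₂ s) zero    (suc j) on₁ on₂ = contradiction on₂ (infinite-not-on s j)
    line-unique (inj₂ s) (suc i) _       on₁ on₂ = contradiction on₁ (infinite-not-on s i)

    -- Up to the order of the points, each number of points on x = 0 is one case.
    det≉0 : ∀ r s t → ¬ (r Parameter.≈ s) → ¬ (r Parameter.≈ t) → ¬ (s Parameter.≈ t) →
            (∀ i → ¬ (point r on Ψ i × point s on Ψ i × point t on Ψ i)) →
            det (vec r) (vec s) (vec t) ≉0
    det≉0 (inj₁ u) (inj₁ v) (inj₁ w) r≉s r≉t s≉t ¬aligned =
      det-affine≉0 u v w (r≉s ∘ inj₁) (r≉t ∘ inj₁) (s≉t ∘ inj₁) λ (gu≈gv , gu≈gw) →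
        let i = E.index (g u) ; gu≈ = sym (E.elem-index (g u)) in
        ¬aligned (suc i) ( on-affine u i gu≈ , on-affine v i (trans (sym gu≈gv) gu≈)
                         , on-affine w i (trans (sym gu≈gw) gu≈))
    det≉0 (inj₁ u) (inj₁ v) (inj₂ t) r≉s r≉t s≉t _ = det-affine-infinite≉0 u v t (r≉s ∘ inj₁)
    det≉0 (inj₁ u) (inj₂ s) (inj₁ w) r≉s r≉t s≉t _ =
      det-affine-infinite≉0 u w s (r≉t ∘ inj₁) ∘ trans (det-swap₁₂ (vec (inj₁ u)) (vec (inj₁ w)) (vec (inj₂ s)))
    det≉0 (inj₁ u) (inj₂ s) (inj₂ t) r≉s r≉t s≉t _ = det-infinite≉0 u s t (s≉t ∘ inj₂)
    det≉0 (inj₂ r) (inj₁ v) (inj₁ w) r≉s r≉t s≉t _ =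
      det-affine-infinite≉0 v w r (s≉t ∘ inj₁) ∘ trans (trans
        (det-swap₁₂ (vec (inj₁ v)) (vec (inj₁ w)) (vec (inj₂ r))) (det-swap₀₁ (vec (inj₁ v)) (vec (inj₂ r)) (vec (inj₁ w))))
    det≉0 (inj₂ r) (inj₁ v) (inj₂ t) r≉s r≉t s≉t _ =
      det-infinite≉0 v r t (r≉t ∘ inj₂) ∘ trans (det-swap₀₁ (vec (inj₁ v)) (vec (inj₂ r)) (vec (inj₂ t)))
    det≉0 (inj₂ r) (inj₂ s) (inj₁ w) r≉s r≉t s≉t _ =
      det-infinite≉0 w r s (r≉s ∘ inj₂) ∘ trans (trans
        (det-swap₀₁ (vec (inj₁ w)) (vec (inj₂ r)) (vec (inj₂ s))) (det-swap₁₂ (vec (inj₂ r)) (vec (inj₁ w)) (vec (inj₂ s))))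
    det≉0 (inj₂ r) (inj₂ s) (inj₂ t) r≉s r≉t s≉t ¬aligned =
      contradiction (on-infinite r , on-infinite s , on-infinite t) (¬aligned zero)

    -- Points of K on each line

    fibre-count : ∀ y → ∃[ k ] (restrict setoid (λ w → g w ≈ y) HasSize k × (Image y → k ≡ h) × (¬ Image y → k ≡ 0))
    fibre-count y with Image? y
    ... | yes im = h , fibre-size im , (λ _ → ≡.refl) , contradiction im
    ... | no ¬im = 0 , hasSize (restrict setoid (λ w → g w ≈ y)) (λ ()) (λ { {()} }) (λ im → contradiction im ¬im)
                 , (λ im → contradiction im ¬im) , (λ _ → ≡.refl)

    -- The number of points of K on each line of the pencil Ψ.
    hs : Fin (suc N) → ℕ
    hs zero    = h
    hs (suc i) = proj₁ (fibre-count (E.elem i))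

    line-size : ∀ i → ∣ K ∩ PointsOf (Ψ i) ∣≡ hs i
    line-size zero = size-map
      {S = restrict setoid (Ker g)} {T = restrict homogeneousSetoid (K ∩ PointsOf (Ψ zero))}
      (λ s → point (inj₂ s) , point∈K (inj₂ s) , on-infinite s)
      (λ {s} {t} s≈t → point-cong {inj₂ s} {inj₂ t} (inj₂ s≈t))
      (λ {s} {t} eq → Sum.drop-inj₂ (point-injective (inj₂ s) (inj₂ t) eq))
      surj kernel
      where
      surj : (y : Σ Point (K ∩ PointsOf (Ψ zero))) → ∃[ s ] point (inj₂ s) ∼ proj₁ y
      surj (p , (inj₁ w , p∼r) , on) = contradiction
        (on-respects (Ψ zero) (point (inj₁ w)) p (H.sym {p} {point (inj₁ w)} p∼r) on) (affine-not-on w)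
      surj (p , (inj₂ s , p∼r) , on) = s , H.sym {p} {point (inj₂ s)} p∼r
    line-size (suc i) = size-map
      {S = restrict setoid (λ w → g w ≈ E.elem i)} {T = restrict homogeneousSetoid (K ∩ PointsOf (Ψ (suc i)))}
      (λ (w , gw≈) → point (inj₁ w) , point∈K (inj₁ w) , on-affine w i gw≈)
      (λ w≈z → point-cong {inj₁ _} {inj₁ _} (inj₁ w≈z))
      (λ {w} {z} eq → Sum.drop-inj₁ (point-injective (inj₁ (proj₁ w)) (inj₁ (proj₁ z)) eq))
      surj (proj₁ (proj₂ (fibre-count (E.elem i))))
      where
      surj : (y : Σ Point (K ∩ PointsOf (Ψ (suc i)))) →
             Σ (Σ Carrier λ w → g w ≈ E.elem i) λ w → point (inj₁ (proj₁ w)) ∼ proj₁ y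
      surj (p , (inj₁ w , p∼r) , on) =
        (w , affine-on w i (on-respects (Ψ (suc i)) (point (inj₁ w)) p (H.sym {p} {point (inj₁ w)} p∼r) on)) , H.sym {p} {point (inj₁ w)} p∼r
      surj (p , (inj₂ s , p∼r) , on) = contradiction
        (on-respects (Ψ (suc i)) (point (inj₂ s)) p (H.sym {p} {point (inj₂ s)} p∼r) on) (infinite-not-on s i)

    K-size : ∣ K ∣≡ (N ℕ.+ h)
    K-size = size-map {S = Parameter} {T = restrict homogeneousSetoid K}
      (λ r → point r , point∈K r) (λ {r} {s} → point-cong {r} {s}) (λ {r} {s} → point-injective r s)
      (λ (p , r , p∼r) → r , H.sym {p} {point r} p∼r)
      (size-⊎ {S = setoid} {T = restrict setoid (Ker g)} order kernel)

    isParc : IsParc (pencil (proj₁ slopes)) hs (N ℕ.+ h) K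
    isParc = record
      { respects    = λ {p} {p′} p∼p′ (r , p∼r) → r , H.trans {p′} {p} {point r} (H.sym {p} {p′} p∼p′) p∼r
      ; size        = K-size
      ; arcs        = λ i → record
          { onLine      = proj₂
          ; size        = line-size i
          ; independent = λ {u} {v} _ _ → independent-pair {u} {v}
          }
      ; disjoint    = λ {i} {j} i≢j p ((r , p∼r) , onᵢ , onⱼ) →
          i≢j (line-unique r i j (on-respects (Ψ i) (point r) p (H.sym {p} {point r} p∼r) onᵢ)
                                 (on-respects (Ψ j) (point r) p (H.sym {p} {point r} p∼r) onⱼ))
      ; independent = λ {u} {v} {w} → triple {u} {v} {w}
      }
      where
      triple : ∀ {p p′ p″} → K p → K p′ → K p″ → ¬ (p ∼ p′) → ¬ (p ∼ p″) → ¬ (p′ ∼ p″) →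
               (∀ i → ¬ (p on Ψ i × p′ on Ψ i × p″ on Ψ i)) →
               LinearlyIndependent (coords p Vector.∷ coords p′ Vector.∷ coords p″ Vector.∷ Vector.[])
      triple {p} {p′} {p″} (r , p∼r) (s , p′∼s) (t , p″∼t) p≁p′ p≁p″ p′≁p″ ¬aligned =
        independent-scale
          (coords p Vector.∷ coords p′ Vector.∷ coords p″ Vector.∷ Vector.[])
          (vec r Vector.∷ vec s Vector.∷ vec t Vector.∷ Vector.[])
          (λ { 0F → p∼r ; 1F → p′∼s ; 2F → p″∼t })
          (det≉0⇒independent (det≉0 r s t
            (p≁p′ ∘ distinct p p′ r s p∼r p′∼s) (p≁p″ ∘ distinct p p″ r t p∼r p″∼t) (p′≁p″ ∘ distinct p′ p″ s t p′∼s p″∼t)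
            λ i (on₁ , on₂ , on₃) → ¬aligned i
              (on-respects (Ψ i) p (point r) p∼r on₁ , on-respects (Ψ i) p′ (point s) p′∼s on₂
              , on-respects (Ψ i) p″ (point t) p″∼t on₃)))
        where
        distinct : ∀ x y r s → x ∼ point r → y ∼ point s → r Parameter.≈ s → x ∼ y
        distinct x y r s x∼r y∼s r≈s = H.trans {x} {point r} {y} x∼r
          (H.trans {point r} {point s} {y} (point-cong {r} {s} r≈s) (H.sym {y} {point s} y∼s))

    r≤N : r ≤ N
    r≤N = size-≤ {S = restrict setoid Image} {T = setoid} proj₁ (λ eq → eq) (proj₂ image-size) order

    isRegularParc : IsRegularParc N (suc r) h K
    isRegularParc = s≤s r≤N , pencil (proj₁ slopes) , hs , N ℕ.+ h , isParc , meets , misses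
      where
      meets : ∀ i → toℕ i < suc r → hs i ≡ h
      meets zero    _         = ≡.refl
      meets (suc i) (s≤s i<r) = proj₁ (proj₂ (proj₂ (fibre-count (E.elem i)))) (proj₁ (proj₂ slopes) i i<r)
      misses : ∀ i → suc r ≤ toℕ i → hs i ≡ 0
      misses (suc i) (s≤s r≤i) = proj₂ (proj₂ (proj₂ (fibre-count (E.elem i)))) (proj₂ (proj₂ slopes) i r≤i)

-- Regular parcs over fields of order q²

prime-power-even : ∀ {p} e → Prime p → 2 ∣ p ℕ.^ e → p ≡ 2
prime-power-even         zero    _       2∣1 = contradiction (∣1⇒≡1 2∣1) λ ()
prime-power-even {p = p} (suc e) p-prime 2∣pᵉ⁺¹ with euclidsLemma p (p ℕ.^ e) prime[2] 2∣pᵉ⁺¹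
... | inj₂ 2∣pᵉ = prime-power-even e p-prime 2∣pᵉ
... | inj₁ 2∣p with prime⇒irreducible p-prime 2∣p
...   | inj₂ 2≡p = ≡.sym 2≡p

open import Data.Nat.Base using (_+_; _*_; _^_)

theorem5p3 : {c ℓ₁ ℓ₂ : Level} (q : ℕ) → IsPrimePower q → 2 ∣ q →
    (F : HeytingField c ℓ₁ ℓ₂) → HasOrder F (q ^ 2) →
    let open ProjectivePlane F in
    RegularParc (q ^ 2) (q + 1) q ×
    RegularParc (q ^ 2) ((q + 2) / 2) (2 * q)
theorem5p3 q (p , zero  , p-prime , () , _)
theorem5p3 q (p , suc e , p-prime , _ , ≡.refl) 2∣q F order with prime-power-even (suc e) p-prime 2∣q
... | ≡.refl =
    (P₀.K , ≡.subst (λ m → IsRegularParc (q ^ 2) m q P₀.K) r₀+1≡q+1 P₀.isRegularParc)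
  , (P₁.K , ≡.subst (λ m → IsRegularParc (q ^ 2) m (2 * q) P₁.K) r₁+1≡[q+2]/2 P₁.isRegularParc)
  where
  open ProjectivePlane F using (IsRegularParc)
  q²≡q*q : q ^ 2 ≡ q * q
  q²≡q*q = ≡.cong (q *_) (ℕ.*-identityʳ q)
  module QE = QuadraticExtension F order e q²≡q*q
  module P₀ = QE.PencilArc QE.0# (inj₁ QE.refl) QE.ker-g₀-size
  module P₁ = QE.PencilArc QE.1# (inj₂ QE.refl) QE.ker-g₁-size
  instance
    q≢0 : ℕ.NonZero q
    q≢0 = ℕ.m^n≢0 2 (suc e)
  r₀+1≡q+1 : suc P₀.r ≡ q + 1
  r₀+1≡q+1 = ≡.trans (≡.cong suc (ℕ.*-cancelʳ-≡ P₀.r q q (≡.trans P₀.r*h≡N q²≡q*q))) (ℕ.+-comm 1 q)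
  r₁*2≡q : P₁.r * 2 ≡ q
  r₁*2≡q = ℕ.*-cancelʳ-≡ (P₁.r * 2) q q
    (≡.trans (ℕ.*-assoc P₁.r 2 q) (≡.trans P₁.r*h≡N q²≡q*q))
  r₁+1≡[q+2]/2 : suc P₁.r ≡ (q + 2) / 2
  r₁+1≡[q+2]/2 = begin
    suc P₁.r              ≡⟨ m*n/n≡m (suc P₁.r) 2 ⟨
    (2 + P₁.r * 2) / 2    ≡⟨ /-congˡ {o = 2} (ℕ.+-comm 2 (P₁.r * 2)) ⟩
    (P₁.r * 2 + 2) / 2    ≡⟨ ≡.cong (λ n → (n + 2) / 2) r₁*2≡q ⟩
    (q + 2) / 2           ∎
    where open ≡.≡-Reasoning
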